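{- Let $n\ge3$. The zeta map $\zeta_D:\mathcal L^\bullet_{n-1,n}\to\mathcal B^\bullet_{2n-1}$ is a bijection from signed lattice paths to signed ballot paths.
   Context: A signed lattice path is a word in $\{N,E\}$ with $n-1$ East steps and $n$ North steps, except that if its first step is East, this step is replaced by $E^+$ or $E^-$ (signed steps count as East steps); the set is $\mathcal L^\bullet_{n-1,n}$, and $\epsilon(\pi)=-1$ if $\pi$ contains $E^-$, else $1$. A signed ballot path is a word of length $2n-1$ in $\{N,E\}$ all of whose prefixes have at least as many $N$'s as $E$'s, except that if its $n$-th North step is immediately followed by an East step, this East step is replaced by $E^+$ or $E^-$; the set is $\mathcal B^\bullet_{2n-1}$. For $\pi\in\mathcal L^\bullet_{n-1,n}$ let $\pi_i$ be the number of East steps before the $i$-th North step; $\lambda_1=\epsilon(\pi)\pi_1$, $\lambda_i=\pi_i$ ($1<i<n$), $\lambda_n=2\pi_n-\pi_{n-1}$ if $\pi_1+\dots+\pi_{n-2}$ is even and $2n-1-2\pi_n+\pi_{n-1}$ if odd. Area vector: $\mu=(\lambda_1,\lambda_2-1,\dots,\lambda_{n-1}-(n-2),\lambda_n-(n-1))$ if $n-1\equiv0,3\pmod4$, and $\mu=(-\lambda_1,\lambda_2-1,\dots,\lambda_{n-1}-(n-2),n-\lambda_n)$ if $n-1\equiv1,2\pmod4$. For $a\in\mathbb Z^n$, $j\ge0$: $\overrightarrow{S}^+_j(a)$ reads $a$ left to right writing $N$ for entries $j$ and $E$ for entries $j+1$; $\overleftarrow{S}^+_j(a)$ reads right to left;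 $\overrightarrow{S}^-_j,\overleftarrow{S}^-_j$ likewise with $N$ for $-j$ and $E$ for $-j-1$. $\zeta_D(\pi)$ is obtained from $\overleftarrow{S}^-_{2n-1}(\mu)\overrightarrow{S}^+_{2n-1}(\mu)\cdots\overleftarrow{S}^-_0(\mu)\overrightarrow{S}^+_0(\mu)$ by deleting the last letter and, if the $n$-th North step is immediately followed by an East step, replacing that East step by $E^+$ if $\#\{r:\mu_r>0\}$ is even and by $E^-$ if odd. -}

module Defs where

open import Data.Bool using (Bool; true; false; if_then_else_; _∨_)
open import Data.Nat using (ℕ; zero; suc; _+_; _*_; _∸_; _≤_; _≡ᵇ_; _%_)
open import Data.Integer as ℤ using (ℤ; +_; -[1+_]) renaming (_+_ to _+ℤ_; _-_ to _-ℤ_; -_ to -ℤ_)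
open import Data.List using (List; []; _∷_; _++_; [_]; map; reverse; concatMap; upTo; downFrom; length)
open import Data.Nat.ListAction using (sum)
open import Data.List.Relation.Unary.All using (All)
open import Data.Product using (Σ; ∃; _×_; _,_)
open import Data.Sum using (_⊎_)
open import Relation.Binary.PropositionalEquality using (_≡_; _≢_)
open import Relation.Nullary using (¬_; does)

data Step : Set where
  N E E⁺ E⁻ : Step

Plain : Step → Set
Plain s = s ≡ N ⊎ s ≡ E

isEast : Step → Bool
isEast N = false
isEast _ = true

countN : List Step → ℕ
countN []      = 0
countN (N ∷ w) = suc (countN w)
countN (_ ∷ w) = countN w

countEast : List Step → ℕ
countEast []      = 0
countEast (N ∷ w) = countEast w
countEast (_ ∷ w) = suc (countEast w)

-- every step is N or E, except the first one, which is N, E⁺ or E⁻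
-- (i.e. a first East step is replaced by E⁺ or E⁻)
LatticeShape : List Step → Set
LatticeShape []      = Data.Unit.⊤ where import Data.Unit
LatticeShape (x ∷ w) = x ≢ E × All Plain w

SignedLatticePath : ℕ → List Step → Set
SignedLatticePath n w =
  countN w ≡ n × countEast w ≡ n ∸ 1 × LatticeShape w

EndsWithNthNorth : ℕ → List Step → Set
EndsWithNthNorth n p = ∃ λ p′ → p ≡ p′ ++ [ N ] × countN p′ ≡ n ∸ 1

Ballot : List Step → Set
Ballot w = ∀ p q → p ++ q ≡ w → countEast p ≤ countN p

BallotShape : ℕ → List Step → Set
BallotShape n w = ∀ p x q → p ++ x ∷ q ≡ w →
  (EndsWithNthNorth n p → x ≢ E) × (¬ EndsWithNthNorth n p → Plain x)

SignedBallotPath : ℕ → List Step → Set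
SignedBallotPath n w =
  length w ≡ 2 * n ∸ 1 × Ballot w × BallotShape n w

eastsBeforeNorths : ℕ → List Step → List ℕ
eastsBeforeNorths e []      = []
eastsBeforeNorths e (N ∷ w) = e ∷ eastsBeforeNorths e w
eastsBeforeNorths e (_ ∷ w) = eastsBeforeNorths (suc e) w

at : List ℕ → ℕ → ℕ
at []       _       = 0
at (x ∷ xs) zero    = x
at (x ∷ xs) (suc i) = at xs i

-- π_i for i = 1 … n
piAt : List Step → ℕ → ℕ
piAt π i = at (eastsBeforeNorths 0 π) (i ∸ 1)

containsE⁻ : List Step → Bool
containsE⁻ []       = false
containsE⁻ (E⁻ ∷ w) = true
containsE⁻ (_ ∷ w)  = containsE⁻ w

lam1 : List Step → ℤ
lam1 π = if containsE⁻ π then -ℤ (+ piAt π 1) else + piAt π 1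

isEven : ℕ → Bool
isEven m = m % 2 ≡ᵇ 0

lamN : ℕ → List Step → ℤ
lamN n π =
  if isEven (sum (map (λ k → piAt π (suc k)) (upTo (n ∸ 2))))
  then (+ (2 * piAt π n)) -ℤ (+ piAt π (n ∸ 1))
  else ((+ (2 * n ∸ 1)) -ℤ (+ (2 * piAt π n))) +ℤ (+ piAt π (n ∸ 1))

case03 : ℕ → Bool
case03 n = ((n ∸ 1) % 4 ≡ᵇ 0) ∨ ((n ∸ 1) % 4 ≡ᵇ 3)

-- the entries λ_i - (i-1) for 1 < i < n
muMiddle : ℕ → List Step → List ℤ
muMiddle n π = map (λ k → (+ piAt π (k + 2)) -ℤ (+ (k + 1))) (upTo (n ∸ 2))

mu : ℕ → List Step → List ℤ
mu n π =
  if case03 n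
  then lam1 π ∷ (muMiddle n π ++ [ lamN n π -ℤ (+ (n ∸ 1)) ])
  else -ℤ (lam1 π) ∷ (muMiddle n π ++ [ (+ n) -ℤ lamN n π ])

eqℤ : ℤ → ℤ → Bool
eqℤ x y = does (x ℤ.≟ y)

letter⁺ : ℕ → ℤ → List Step
letter⁺ j x = if eqℤ x (+ j) then [ N ] else (if eqℤ x (+ suc j) then [ E ] else [])

letter⁻ : ℕ → ℤ → List Step
letter⁻ j x = if eqℤ x (-ℤ (+ j)) then [ N ] else (if eqℤ x (-ℤ (+ suc j)) then [ E ] else [])

S⁺→ S⁺← S⁻→ S⁻← : ℕ → List ℤ → List Step
S⁺→ j a = concatMap (letter⁺ j) a
S⁺← j a = concatMap (letter⁺ j) (reverse a)
S⁻→ j a = concatMap (letter⁻ j) a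
S⁻← j a = concatMap (letter⁻ j) (reverse a)

zetaWord : ℕ → List ℤ → List Step
zetaWord n a = concatMap (λ j → S⁻← j a ++ S⁺→ j a) (downFrom (2 * n))

dropLast : List Step → List Step
dropLast []          = []
dropLast (x ∷ [])    = []
dropLast (x ∷ y ∷ w) = x ∷ dropLast (y ∷ w)

-- if the North step counted by k (k = number of N's still to pass,
-- the last of them being the target one) is immediately followed by E,
-- replace that E by s
signAfter : ℕ → Step → List Step → List Step
signAfter zero          s w            = w
signAfter (suc k)       s []           = []
signAfter (suc zero)    s (N ∷ E ∷ w)  = N ∷ s ∷ w
signAfter (suc zero)    s (N ∷ w)      = N ∷ w
signAfter (suc (suc k)) s (N ∷ w)      = N ∷ signAfter (suc k) s w
signAfter (suc k)       s (x ∷ w)      = x ∷ signAfter (suc k) s w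

isPos : ℤ → Bool
isPos (+ suc _) = true
isPos _         = false

countPos : List ℤ → ℕ
countPos []       = 0
countPos (x ∷ xs) = if isPos x then suc (countPos xs) else countPos xs

zetaD : ℕ → List Step → List Step
zetaD n π =
  signAfter n (if isEven (countPos (mu n π)) then E⁺ else E⁻)
              (dropLast (zetaWord n (mu n π)))

{-# OPTIONS --safe #-}
-- Read from the outermost level inwards, the word of a vector a consists of the
-- letters of the nonnegative entries of (-aₙ, …, -a₁, a₁, …, aₙ).  For a = μ(π)
-- with a₁ replaced by its absolute value and aₙ by min(aₙ, 1 - aₙ), which changes
-- at most the last letter of the word, these entries are the depths of the nodes of
-- a forest in postorder, and the word lists the numbers of children in reverse
-- breadth-first order.  Rebuilding the forest from the word with a queue is a
-- reversible process that runs on exactly the ballot words, whence the bijection on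
-- unsigned paths.  The n-th N is followed by E exactly when a₁ ≠ 0, and then the sign
-- put there determines that of a₁, all other entries being known.
module Submission where

open import Defs
open import Data.Bool using (Bool; true; false; if_then_else_; not)
open import Data.Empty using (⊥-elim)
open import Data.Integer as ℤ using (ℤ; +_; -[1+_]; 0ℤ; 1ℤ; -1ℤ; +≤+; -≤+; -≤-)
open import Data.Integer.Properties as ℤ using ()
open import Data.Integer.Tactic.RingSolver as ℤ-Ring using ()
open import Data.List using (List; []; _∷_; _++_; [_]; map; reverse; _ʳ++_; concatMap; upTo; applyUpTo;
  downFrom; length; replicate; take; drop; initLast; _∷ʳ′_)
open import Data.List.Properties
open import Data.List.Relation.Unary.All as All using (All; []; _∷_)
open import Data.List.Relation.Unary.All.Properties as All using ()
open import Data.List.Relation.Unary.Linked as Linked using (Linked; [-]; []; _∷_)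
open import Data.Nat using (ℕ; zero; suc; _+_; _*_; _∸_; _≤_; _<_; z≤n; s≤s; _≡ᵇ_)
open import Data.Nat.ListAction using (sum)
open import Data.Nat.Properties as ℕ using ()
open import Data.Nat.Tactic.RingSolver as ℕ-Ring using ()
open import Data.Product using (Σ; ∃; ∃₂; _×_; _,_; proj₁; proj₂)
open import Data.Sum using (_⊎_; inj₁; inj₂)
open import Data.Unit using (⊤; tt)
open import Relation.Binary.PropositionalEquality hiding ([_])
open import Relation.Nullary using (¬_)

-- Forests and the queue machine

-- The parity and mod 4 cases in the definition of `mu` do not affect the unsigned word: they only
-- exchange the last entry `x` with `1 - x`. Both give the same word before its last letter, because
-- `k + 1` read at the right end of level `j + 1` and `k` read at the left end of level `j` write
-- the same letter at the same place. The last entry may thus be taken nonpositive, and this lets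
-- the symmetrised vector end with a root, as a postorder must. Conversely, a forest has to be cut
-- into a half for the nonpositive entries and one for the nonnegative entries. A 0 of the vector is
-- read twice and every other entry once, so the number of roots is even and the cut lies in the
-- middle. That the two halves interleave in only one way comes from the entries falling by at most
-- one from each position to the next.

letter : ℕ → ℕ → List Step
letter j x = if x ≡ᵇ j then [ N ] else (if x ≡ᵇ suc j then [ E ] else [])

level : ℕ → List ℕ → List Step
level j = concatMap (letter j)

levels : ℕ → List ℕ → List Step
levels M l = concatMap (λ j → level j l) (downFrom M)

level-++ : ∀ j l l′ → level j (l ++ l′) ≡ level j l ++ level j l′
level-++ j = concatMap-++ (letter j)

-- Splits off the innermost level, whereas the recursion of `downFrom` exposes the outermost one.
-- Induction on forests needs the innermost: deleting the roots lowers all other depths by one.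
levels-suc : ∀ l (h : ℕ → List Step) → (∀ j → level (suc j) l ≡ h j) →
             ∀ M → levels (suc M) l ≡ concatMap h (downFrom M) ++ level 0 l
levels-suc l h eq zero    = ++-identityʳ _
levels-suc l h eq (suc M) =
  trans (cong₂ _++_ (eq M) (levels-suc l h eq M))
        (sym (++-assoc (h M) (concatMap h (downFrom M)) (level 0 l)))

data Tree : Set where
  node : List Tree → Tree

-- The depths of the nodes of a forest in postorder.
depths : List Tree → List ℕ
depths []            = []
depths (node cs ∷ f) = map suc (depths cs) ++ 0 ∷ depths f

children : List Tree → List Tree
children []            = []
children (node cs ∷ f) = cs ++ children f

depths-++ : ∀ f g → depths (f ++ g) ≡ depths f ++ depths g
depths-++ []            g = refl
depths-++ (node cs ∷ f) g =
  trans (cong (λ u → map suc (depths cs) ++ 0 ∷ u) (depths-++ f g))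
        (sym (++-assoc (map suc (depths cs)) _ _))

level-suc : ∀ j l → level (suc j) (map suc l) ≡ level j l
level-suc j = concatMap-map (letter (suc j)) suc

-- Deleting the roots keeps the postorder of the remaining nodes and lowers their depths by one, and
-- a root itself has no letter in a level above 0.
level-depths : ∀ j f → level (suc j) (depths f) ≡ level j (depths (children f))
level-depths j []            = refl
level-depths j (node cs ∷ f) = begin
  level (suc j) (map suc (depths cs) ++ 0 ∷ depths f)
    ≡⟨ level-++ (suc j) (map suc (depths cs)) _ ⟩
  level (suc j) (map suc (depths cs)) ++ level (suc j) (depths f)
    ≡⟨ cong₂ _++_ (level-suc j (depths cs)) (level-depths j f) ⟩
  level j (depths cs) ++ level j (depths (children f))
    ≡⟨ level-++ j (depths cs) _ ⟨
  level j (depths cs ++ depths (children f))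
    ≡⟨ cong (level j) (depths-++ cs (children f)) ⟨
  level j (depths (cs ++ children f)) ∎
  where open ≡-Reasoning

-- After the shift only the former roots have depth 1. Hence, in level 0, the `N` of a root is
-- preceded by one `E` for each of its children.
level₀-suc : ∀ f → level 0 (map suc (depths f)) ≡ replicate (length f) E
level₀-suc []            = refl
level₀-suc (node cs ∷ f) = begin
  level 0 (map suc (map suc (depths cs) ++ 0 ∷ depths f))
    ≡⟨ cong (level 0) (map-++ suc (map suc (depths cs)) _) ⟩
  level 0 (map suc (map suc (depths cs)) ++ 1 ∷ map suc (depths f))
    ≡⟨ level-++ 0 (map suc (map suc (depths cs))) _ ⟩
  level 0 (map suc (map suc (depths cs))) ++ E ∷ level 0 (map suc (depths f))
    ≡⟨ cong₂ (λ u v → u ++ E ∷ v) (two (depths cs)) (level₀-suc f) ⟩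
  replicate (suc (length f)) E ∎
  where
  open ≡-Reasoning
  two : ∀ l → level 0 (map suc (map suc l)) ≡ []
  two []      = refl
  two (x ∷ l) = two l

-- Run r Q P: after reading r backwards, Q is the queue of finished trees and P
-- holds the children of the next node.  E moves the front of Q to P, and N puts
-- the node with children P at the end of Q.
data Run : List Step → List Tree → List Tree → Set where
  start : Run [] [] []
  north : ∀ {r Q P Q′} → Run r Q P → Q′ ≡ Q ++ [ node P ] → Run (N ∷ r) Q′ []
  east  : ∀ {r t Q P P′} → Run r (t ∷ Q) P → P′ ≡ P ++ [ t ] → Run (E ∷ r) Q P′

snoc≢[] : ∀ {A : Set} (xs : List A) {x} → ¬ ([] ≡ xs ++ [ x ])
snoc≢[] []       ()
snoc≢[] (_ ∷ xs) ()

Run-functional : ∀ {r Q P Q′ P′} → Run r Q P → Run r Q′ P′ → Q ≡ Q′ × P ≡ P′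
Run-functional start       start        = refl , refl
Run-functional (north a e) (north a′ e′) with Run-functional a a′
... | refl , refl = trans e (sym e′) , refl
Run-functional (east a e)  (east a′ e′) with Run-functional a a′
... | refl , refl = refl , trans e (sym e′)

-- The state reveals the last letter: `E` leaves `P` nonempty, `N` leaves `P` empty and `Q`
-- nonempty, and at the start both are empty. Each step can then be undone.
Run-injective : ∀ {r r′ Q P} → Run r Q P → Run r′ Q P → r ≡ r′
Run-injective start       start = refl
Run-injective start       (north {Q = Q} _ e) = ⊥-elim (snoc≢[] Q e)
Run-injective start       (east {P = P} _ e) = ⊥-elim (snoc≢[] P e)
Run-injective (north {Q = Q} _ e) start = ⊥-elim (snoc≢[] Q e)
Run-injective (east {P = P} _ e)  start = ⊥-elim (snoc≢[] P e)
Run-injective (north _ _) (east {P = P} _ e) = ⊥-elim (snoc≢[] P e)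
Run-injective (east {P = P} _ e) (north _ _) = ⊥-elim (snoc≢[] P e)
Run-injective (north {Q = Q} a e) (north {Q = Q′} a′ e′)
  with ∷ʳ-injective Q Q′ (trans (sym e) e′)
... | refl , refl = cong (N ∷_) (Run-injective a a′)
Run-injective (east {P = P} a e) (east {P = P′} a′ e′)
  with ∷ʳ-injective P P′ (trans (sym e) e′)
... | refl , refl = cong (E ∷_) (Run-injective a a′)

Run-suffix : ∀ r₁ {r₂ Q P} → Run (r₁ ++ r₂) Q P → ∃₂ λ Q′ P′ → Run r₂ Q′ P′
Run-suffix []       a           = _ , _ , a
Run-suffix (_ ∷ r₁) (north a _) = Run-suffix r₁ a
Run-suffix (_ ∷ r₁) (east a _)  = Run-suffix r₁ a

-- `N` lengthens the queue by one tree and `E` shortens it by one. The length of the queue is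
-- therefore the height of the path, and the machine gets stuck only where the ballot condition
-- fails.
Run-height : ∀ {r Q P} → Run r Q P → countEast r + length Q ≡ countN r
Run-height start = refl
Run-height (north {r} {Q} {P} a refl) = begin
  countEast r + length (Q ++ [ node P ]) ≡⟨ cong (λ u → countEast r + u) (length-++ Q) ⟩
  countEast r + (length Q + 1)           ≡⟨ rearrange (countEast r) (length Q) ⟩
  suc (countEast r + length Q)           ≡⟨ cong suc (Run-height a) ⟩
  suc (countN r) ∎
  where
  open ≡-Reasoning
  rearrange : ∀ a b → a + (b + 1) ≡ suc (a + b)
  rearrange = ℕ-Ring.solve-∀
Run-height (east {r} {t} {Q} a _) = trans (sym (ℕ.+-suc (countEast r) (length Q))) (Run-height a)

size : List Tree → ℕ
size f = length (depths f)

size-++ : ∀ f g → size (f ++ g) ≡ size f + size g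
size-++ f g = trans (cong length (depths-++ f g)) (length-++ (depths f))

size-node : ∀ cs f → size (node cs ∷ f) ≡ suc (size cs + size f)
size-node cs f = trans (length-++ (map suc (depths cs)))
  (trans (cong (_+ suc (size f)) (length-map suc (depths cs))) (ℕ.+-suc (size cs) (size f)))

-- Each `N` creates one node; `E` only moves a tree.
Run-countN : ∀ {r Q P} → Run r Q P → countN r ≡ size Q + size P
Run-countN start = refl
Run-countN (north {r} {Q} {P} a refl) = begin
  suc (countN r)                ≡⟨ cong suc (Run-countN a) ⟩
  suc (size Q + size P)         ≡⟨ rearrange (size Q) (size P) ⟩
  size Q + suc (size P + 0) + 0 ≡⟨ cong (λ u → size Q + u + 0) (size-node P []) ⟨
  size Q + size [ node P ] + 0  ≡⟨ cong (_+ 0) (size-++ Q [ node P ]) ⟨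
  size (Q ++ [ node P ]) + 0 ∎
  where
  open ≡-Reasoning
  rearrange : ∀ a b → suc (a + b) ≡ a + suc (b + 0) + 0
  rearrange = ℕ-Ring.solve-∀
Run-countN (east {r} {t} {Q} {P} a refl) = begin
  countN r                     ≡⟨ Run-countN a ⟩
  size (t ∷ Q) + size P        ≡⟨ cong (_+ size P) (size-++ [ t ] Q) ⟩
  size [ t ] + size Q + size P ≡⟨ rearrange (size [ t ]) (size Q) (size P) ⟩
  size Q + (size P + size [ t ]) ≡⟨ cong (λ u → size Q + u) (size-++ P [ t ]) ⟨
  size Q + size (P ++ [ t ]) ∎
  where
  open ≡-Reasoning
  rearrange : ∀ a b c → a + b + c ≡ b + (c + a)
  rearrange = ℕ-Ring.solve-∀

Run-easts : ∀ cs {r Q P} → Run r (cs ++ Q) P →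
            Run (replicate (length cs) E ʳ++ r) Q (P ++ cs)
Run-easts []       {P = P} a = subst (Run _ _) (sym (++-identityʳ P)) a
Run-easts (c ∷ cs) {P = P} a =
  subst (Run _ _) (++-assoc P [ c ] cs) (Run-easts cs (east a refl))

-- The children wait at the front of the queue in the order of their parents, so every parent
-- collects exactly its own and goes to the end. `Q` is arbitrary because the finished parents
-- accumulate there.
Run-level : ∀ f {r Q} → Run r (children f ++ Q) [] → Run (level 0 (depths f) ʳ++ r) (Q ++ f) []
Run-level []            {Q = Q} a = subst (λ u → Run _ u _) (sym (++-identityʳ Q)) a
Run-level (node cs ∷ f) {r} {Q} a =
  subst₂ (λ w u → Run w u []) word (++-assoc Q [ node cs ] f)
    (Run-level f {Q = Q ++ [ node cs ]} (subst (λ u → Run _ u _) (++-assoc (children f) Q _)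
      (north (Run-easts cs (subst (λ u → Run r u []) (++-assoc cs (children f) Q) a)) refl)))
  where
  open ≡-Reasoning
  word : level 0 (depths f) ʳ++ N ∷ (replicate (length cs) E ʳ++ r)
         ≡ level 0 (depths (node cs ∷ f)) ʳ++ r
  word = begin
    (N ∷ level 0 (depths f)) ʳ++ replicate (length cs) E ʳ++ r
      ≡⟨ ++-ʳ++ (replicate (length cs) E) ⟨
    (replicate (length cs) E ++ N ∷ level 0 (depths f)) ʳ++ r
      ≡⟨ cong (λ u → (u ++ N ∷ level 0 (depths f)) ʳ++ r) (level₀-suc cs) ⟨
    (level 0 (map suc (depths cs)) ++ N ∷ level 0 (depths f)) ʳ++ r
      ≡⟨ cong (_ʳ++ r) (level-++ 0 (map suc (depths cs)) _) ⟨
    level 0 (depths (node cs ∷ f)) ʳ++ r ∎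

children-bound : ∀ M f → All (_< suc M) (depths f) → All (_< M) (depths (children f))
children-bound M []            b = []
children-bound M (node cs ∷ f) b with All.++⁻ (map suc (depths cs)) b
... | b₁ , _ ∷ b₂ = subst (All (_< M)) (sym (depths-++ cs (children f)))
  (All.++⁺ (All.map ℕ.≤-pred (All.map⁻ b₁)) (children-bound M f b₂))

-- By induction the deeper levels leave the children of the roots in the queue, and level 0
-- assembles them into `f`.
Run-levels : ∀ M f → All (_< M) (depths f) → Run (reverse (levels M (depths f))) f []
Run-levels zero []            b = start
Run-levels zero (node cs ∷ f) b with All.++⁻ʳ (map suc (depths cs)) b
... | () ∷ _
Run-levels (suc M) f b = subst (λ w → Run w f []) word
  (Run-level f (subst (λ u → Run (reverse (levels M (depths (children f)))) u []) (sym (++-identityʳ (children f)))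
    (Run-levels M (children f) (children-bound M f b))))
  where
  open ≡-Reasoning
  word : level 0 (depths f) ʳ++ reverse (levels M (depths (children f)))
         ≡ reverse (levels (suc M) (depths f))
  word = begin
    level 0 (depths f) ʳ++ reverse (levels M (depths (children f)))
      ≡⟨ ++-ʳ++ (levels M (depths (children f))) ⟨
    reverse (levels M (depths (children f)) ++ level 0 (depths f))
      ≡⟨ cong reverse (levels-suc (depths f) (λ j → level j (depths (children f))) (λ j → level-depths j f) M) ⟨
    reverse (levels (suc M) (depths f)) ∎

-- As `r` is the word reversed, the suffixes `r₂` are prefixes of the word. An `E` meeting an empty
-- queue would come when `N` and `E` are equally many, and so would break the ballot condition.
Run-exists : ∀ r → All Plain r → (∀ r₁ r₂ → r₁ ++ r₂ ≡ r → countEast r₂ ≤ countN r₂) →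
             ∃₂ λ Q P → Run r Q P
Run-exists []      _                h = [] , [] , start
Run-exists (x ∷ r) (px ∷ pr) h with Run-exists r pr (λ r₁ r₂ e → h (x ∷ r₁) r₂ (cong (x ∷_) e))
Run-exists (N ∷ r) (px ∷ pr) h | Q , P , a = _ , _ , north a refl
Run-exists (E ∷ r) (px ∷ pr) h | t ∷ Q , P , a = _ , _ , east a refl
Run-exists (E ∷ r) (px ∷ pr) h | [] , P , a =
  ⊥-elim (ℕ.<-irrefl (trans (sym (ℕ.+-identityʳ _)) (Run-height a)) (h [] (E ∷ r) refl))
Run-exists (E⁺ ∷ r) (inj₁ () ∷ pr) h | _
Run-exists (E⁺ ∷ r) (inj₂ () ∷ pr) h | _
Run-exists (E⁻ ∷ r) (inj₁ () ∷ pr) h | _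
Run-exists (E⁻ ∷ r) (inj₂ () ∷ pr) h | _

-- Vectors and forests

-- The greatest depth of a node that can precede `l` in a postorder: the next node is its parent or
-- lies at least as deep, and a node with nothing after it is a root.
bound : List ℕ → ℕ
bound []      = 0
bound (x ∷ _) = suc x

data Postorder : List ℕ → Set where
  []  : Postorder []
  _∷_ : ∀ {x l} → x ≤ bound l → Postorder l → Postorder (x ∷ l)

Postorder-depths : ∀ f → Postorder (depths f)
Postorder-depths []            = []
Postorder-depths (node cs ∷ f) = go (Postorder-depths cs)
  where
  go : ∀ {l} → Postorder l → Postorder (map suc l ++ 0 ∷ depths f)
  go []              = z≤n ∷ Postorder-depths f
  go {x ∷ []}    (p ∷ q) = s≤s p ∷ go q
  go {x ∷ y ∷ l} (p ∷ q) = s≤s p ∷ go q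

Postorder-< : ∀ {l} → Postorder l → All (_< length l) l
Postorder-< {[]}    []      = []
Postorder-< {x ∷ l} (p ∷ q) =
  s≤s (ℕ.≤-trans p (bound-≤ q)) ∷ All.map ℕ.m≤n⇒m≤1+n (Postorder-< q)
  where
  bound-≤ : ∀ {l} → Postorder l → bound l ≤ length l
  bound-≤ []                = z≤n
  bound-≤ {y ∷ l} (p′ ∷ q′) = s≤s (ℕ.≤-trans p′ (bound-≤ q′))

-- A new first node in postorder is a leaf at the left edge of the forest. The last clause also
-- catches a positive depth in an empty forest, which `depths-insert` excludes by its bound.
insert : ℕ → List Tree → List Tree
insert (suc x) (node cs ∷ f) = node (insert x cs) ∷ f
insert _       f             = node [] ∷ f

bound-depths : ∀ cs f → bound (depths (node cs ∷ f)) ≡ suc (bound (depths cs))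
bound-depths []             f = refl
bound-depths (node ds ∷ cs) f with depths (node ds ∷ cs)
... | []    = refl
... | _ ∷ _ = refl

depths-insert : ∀ x f → x ≤ bound (depths f) → depths (insert x f) ≡ x ∷ depths f
depths-insert zero    f             b = refl
depths-insert (suc x) []            ()
depths-insert (suc x) (node cs ∷ f) b =
  cong (λ u → map suc u ++ 0 ∷ depths f)
    (depths-insert x cs (ℕ.≤-pred (subst (suc x ≤_) (bound-depths cs f) b)))

forest : ∀ {l} → Postorder l → ∃ λ f → depths f ≡ l
forest []              = [] , refl
forest (_∷_ {x} b p) with forest p
... | f , refl = insert x f , depths-insert x f b

infix 4 _⇘_
_⇘_ : ℤ → ℤ → Set
x ⇘ y = x ℤ.≤ ℤ.suc y

-- The 1 in front says that the first entry is at least 0, the -1 behind that the last entry is at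
-- most 0; together they exclude the empty vector.
Core : List ℤ → Set
Core c = Linked _⇘_ (+ 1 ∷ c ++ [ -1ℤ ])

nonneg nonpos : List ℤ → List ℕ
nonneg []             = []
nonneg (+ x ∷ a)      = x ∷ nonneg a
nonneg (-[1+ _ ] ∷ a) = nonneg a
nonpos []              = []
nonpos (+ zero ∷ a)    = 0 ∷ nonpos a
nonpos (+ (suc _) ∷ a) = nonpos a
nonpos (-[1+ x ] ∷ a)  = suc x ∷ nonpos a

-- The nonnegative entries of (-aₙ, …, -a₁, a₁, …, aₙ).
symm : List ℤ → List ℕ
symm a = nonpos a ʳ++ nonneg a

nonneg-++ : ∀ a b → nonneg (a ++ b) ≡ nonneg a ++ nonneg b
nonneg-++ []             b = refl
nonneg-++ (+ x ∷ a)      b = cong (x ∷_) (nonneg-++ a b)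
nonneg-++ (-[1+ _ ] ∷ a) b = nonneg-++ a b

nonpos-++ : ∀ a b → nonpos (a ++ b) ≡ nonpos a ++ nonpos b
nonpos-++ []              b = refl
nonpos-++ (+ zero ∷ a)    b = cong (0 ∷_) (nonpos-++ a b)
nonpos-++ (+ (suc _) ∷ a) b = nonpos-++ a b
nonpos-++ (-[1+ x ] ∷ a)  b = cong (suc x ∷_) (nonpos-++ a b)

S⁺→-level : ∀ j a → S⁺→ j a ≡ level j (nonneg a)
S⁺→-level j []             = refl
S⁺→-level j (+ x ∷ a)      = cong (letter j x ++_) (S⁺→-level j a)
S⁺→-level j (-[1+ _ ] ∷ a) = S⁺→-level j a

S⁻→-level : ∀ j a → S⁻→ j a ≡ level j (nonpos a)
S⁻→-level j       []                = refl
S⁻→-level zero    (+ zero ∷ a)      = cong (N ∷_) (S⁻→-level 0 a)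
S⁻→-level (suc j) (+ zero ∷ a)      = S⁻→-level (suc j) a
S⁻→-level zero    (+ (suc _) ∷ a)   = S⁻→-level 0 a
S⁻→-level (suc j) (+ (suc _) ∷ a)   = S⁻→-level (suc j) a
S⁻→-level zero    (-[1+ x ] ∷ a)    = cong (letter 0 (suc x) ++_) (S⁻→-level 0 a)
S⁻→-level (suc j) (-[1+ x ] ∷ a)    = cong (letter (suc j) (suc x) ++_) (S⁻→-level (suc j) a)

nonpos-reverse : ∀ a → nonpos (reverse a) ≡ reverse (nonpos a)
nonpos-reverse a = go a []
  where
  go : ∀ a b → nonpos (a ʳ++ b) ≡ nonpos a ʳ++ nonpos b
  go []              b = refl
  go (+ zero ∷ a)    b = go a (+ 0 ∷ b)
  go (+ (suc x) ∷ a) b = go a (+ (suc x) ∷ b)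
  go (-[1+ x ] ∷ a)  b = go a (-[1+ x ] ∷ b)

zetaWord-levels : ∀ n a → zetaWord n a ≡ levels (2 * n) (symm a)
zetaWord-levels n a = concatMap-cong step (downFrom (2 * n))
  where
  open ≡-Reasoning
  step : ∀ j → S⁻← j a ++ S⁺→ j a ≡ level j (symm a)
  step j = begin
    S⁻→ j (reverse a) ++ S⁺→ j a
      ≡⟨ cong₂ _++_ (trans (S⁻→-level j (reverse a)) (cong (level j) (nonpos-reverse a))) (S⁺→-level j a) ⟩
    level j (reverse (nonpos a)) ++ level j (nonneg a)
      ≡⟨ level-++ j (reverse (nonpos a)) (nonneg a) ⟨
    level j (reverse (nonpos a) ++ nonneg a)
      ≡⟨ cong (level j) (ʳ++-defn (nonpos a)) ⟨
    level j (symm a) ∎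

⇘-pos : ∀ {x y} → + x ⇘ + y → x ≤ suc y
⇘-pos (+≤+ p) = p

⇘-zero : ∀ {x} y → + x ⇘ -[1+ y ] → x ≡ 0
⇘-zero zero    (+≤+ z≤n) = refl
⇘-zero (suc y) ()

⇘-neg : ∀ {x} y → -[1+ x ] ⇘ -[1+ y ] → y ≤ suc x
⇘-neg zero    p       = z≤n
⇘-neg (suc y) (-≤- p) = s≤s p

-- Skipping a run of negative entries is harmless: a nonnegative entry just before it must be 0, as
-- entries fall by at most one, and 0 may precede anything.
Postorder-nonneg : ∀ c → Linked _⇘_ (c ++ [ -1ℤ ]) → Postorder (nonneg c)
Postorder-nonneg []                 _       = []
Postorder-nonneg (-[1+ _ ] ∷ c)     l       = Postorder-nonneg c (Linked.tail l)
Postorder-nonneg (+ x ∷ c)          l       = first c l ∷ Postorder-nonneg c (Linked.tail l)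
  where
  first : ∀ c → Linked _⇘_ (+ x ∷ c ++ [ -1ℤ ]) → x ≤ bound (nonneg c)
  first []             (p ∷ _) = ℕ.≤-reflexive (⇘-zero 0 p)
  first (+ y ∷ c)      (p ∷ _) = ⇘-pos p
  first (-[1+ y ] ∷ c) (p ∷ _) = subst (_≤ _) (sym (⇘-zero y p)) z≤n

-- What may be put in front of l when l records the nonpositive entries
-- (up to sign, in reverse order) met so far and v is the entry met last.
Ready : ℤ → List ℕ → Set
Ready (+ zero)    l = 1 ≤ bound l
Ready (+ (suc _)) l = ⊤
Ready (-[1+ x ])  l = suc (suc x) ≤ bound l

Postorder-nonpos : ∀ v c l → Linked _⇘_ (v ∷ c ++ [ -1ℤ ]) → Ready v l → Postorder l →
                   Postorder (nonpos c ʳ++ l)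
Postorder-nonpos v []                l _         r p = p
Postorder-nonpos v (+ zero ∷ c)      l (_ ∷ q)   r p =
  Postorder-nonpos (+ 0) c (0 ∷ l) q ℕ.≤-refl (z≤n ∷ p)
Postorder-nonpos v (+ (suc x) ∷ c)   l (_ ∷ q)   r p = Postorder-nonpos _ c l q tt p
Postorder-nonpos (+ zero)    (-[1+ y ] ∷ c) l (d ∷ q) r p =
  Postorder-nonpos _ c (suc y ∷ l) q ℕ.≤-refl (ℕ.≤-trans (s≤s (bd y d)) r ∷ p)
  where
  bd : ∀ y → + 0 ⇘ -[1+ y ] → y ≤ 0
  bd zero    _ = z≤n
  bd (suc y) ()
Postorder-nonpos (+ (suc x)) (-[1+ y ] ∷ c) l (d ∷ q) r p with ⇘-zero y d
... | ()
Postorder-nonpos (-[1+ x ])  (-[1+ y ] ∷ c) l (d ∷ q) r p =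
  Postorder-nonpos _ c (suc y ∷ l) q ℕ.≤-refl (ℕ.≤-trans (s≤s (⇘-neg y d)) r ∷ p)

Postorder-symm : ∀ {c} → Core c → Postorder (symm c)
-- The 1 in front of `c` acts as the entry met before it. A positive entry puts no condition on the
-- list, since the next nonpositive entry can only be 0.
Postorder-symm {c} l = Postorder-nonpos (+ 1) c (nonneg c) l tt (Postorder-nonneg c (Linked.tail l))

-- Falling by at most one, the entries cannot get from a positive value to a negative one, the final
-- -1 included, without taking the value 0.
nonpos-head : ∀ {x} c → Linked _⇘_ (+ (suc x) ∷ c ++ [ -1ℤ ]) → ∃ λ u → nonpos c ≡ 0 ∷ u
nonpos-head [] (p ∷ _) with ⇘-zero 0 p
... | ()
nonpos-head (+ zero ∷ c)    _       = nonpos c , refl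
nonpos-head (+ (suc y) ∷ c) (_ ∷ l) = nonpos-head c l
nonpos-head (-[1+ y ] ∷ c)  (p ∷ _) with ⇘-zero y p
... | ()

zeros : List ℕ → ℕ
zeros []          = 0
zeros (zero ∷ l)  = suc (zeros l)
zeros (suc _ ∷ l) = zeros l

zeros-ʳ++ : ∀ l l′ → zeros (l ʳ++ l′) ≡ zeros l + zeros l′
zeros-ʳ++ []          l′ = refl
zeros-ʳ++ (zero ∷ l)  l′ = trans (zeros-ʳ++ l (0 ∷ l′)) (ℕ.+-suc (zeros l) (zeros l′))
zeros-ʳ++ (suc x ∷ l) l′ = zeros-ʳ++ l (suc x ∷ l′)

zeros-depths : ∀ f → zeros (depths f) ≡ length f
zeros-depths []            = refl
zeros-depths (node cs ∷ f) = trans (go (depths cs)) (cong suc (zeros-depths f))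
  where
  go : ∀ l → zeros (map suc l ++ 0 ∷ depths f) ≡ suc (zeros (depths f))
  go []      = refl
  go (_ ∷ l) = go l

zeros-nonpos : ∀ a → zeros (nonpos a) ≡ zeros (nonneg a)
zeros-nonpos []              = refl
zeros-nonpos (+ zero ∷ a)    = cong suc (zeros-nonpos a)
zeros-nonpos (+ (suc x) ∷ a) = zeros-nonpos a
zeros-nonpos (-[1+ x ] ∷ a)  = zeros-nonpos a

zeros-symm : ∀ a → zeros (symm a) ≡ 2 * zeros (nonneg a)
zeros-symm a = trans (zeros-ʳ++ (nonpos a) (nonneg a))
  (cong₂ _+_ (zeros-nonpos a) (sym (ℕ.+-identityʳ _)))

length-symm : ∀ a → length (symm a) ≡ length a + zeros (nonneg a)
length-symm a = trans (length-ʳ++ (nonpos a)) (go a)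
  where
  go : ∀ a → length (nonpos a) + length (nonneg a) ≡ length a + zeros (nonneg a)
  go []              = refl
  go (+ zero ∷ a)    = cong suc (trans (ℕ.+-suc (length (nonpos a)) _)
    (trans (cong suc (go a)) (sym (ℕ.+-suc (length a) _))))
  go (+ (suc x) ∷ a) = trans (ℕ.+-suc (length (nonpos a)) _) (cong suc (go a))
  go (-[1+ x ] ∷ a)  = cong suc (go a)

split-unique : ∀ u u′ {v v′} → u ++ 0 ∷ v ≡ u′ ++ 0 ∷ v′ → zeros u ≡ zeros u′ → u ≡ u′ × v ≡ v′
split-unique []          []           refl _ = refl , refl
split-unique []          (zero ∷ u′)  e    ()
split-unique []          (suc x ∷ u′) ()   _
split-unique (zero ∷ u)  []           e    ()
split-unique (suc x ∷ u) []           ()   _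
split-unique (x ∷ u)     (x′ ∷ u′)    e    z with ∷-injective e
split-unique (zero ∷ u)  (.zero ∷ u′) e    z | refl , e′ with split-unique u u′ e′ (ℕ.suc-injective z)
... | refl , w = refl , w
split-unique (suc x ∷ u) (.(suc x) ∷ u′) e z | refl , e′ with split-unique u u′ e′ z
... | refl , w = refl , w

-- A 0 heads both lists of parts, so only a positive entry facing a negative one could be ambiguous.
-- By `nonpos-head` the nonpositive entries following a positive one begin with 0, so the two
-- candidates would have different `nonpos`.
merge-unique : ∀ {c c′} → Linked _⇘_ (c ++ [ -1ℤ ]) → Linked _⇘_ (c′ ++ [ -1ℤ ]) →
               nonneg c ≡ nonneg c′ → nonpos c ≡ nonpos c′ → c ≡ c′
merge-unique {[]}             {[]}              l l′ p q = refl
merge-unique {[]}             {+ x ∷ c′}        l l′ () q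
merge-unique {[]}             { -[1+ x ] ∷ c′}  l l′ p ()
merge-unique {+ x ∷ c}        {[]}              l l′ () q
merge-unique { -[1+ x ] ∷ c}  {[]}              l l′ p ()
merge-unique {+ zero ∷ c}     {+ zero ∷ c′}     l l′ p q =
  cong (+ 0 ∷_) (merge-unique (Linked.tail l) (Linked.tail l′) (∷-injectiveʳ p) (∷-injectiveʳ q))
merge-unique {+ zero ∷ c}     {+ (suc y) ∷ c′}  l l′ () q
merge-unique {+ zero ∷ c}     { -[1+ y ] ∷ c′}  l l′ p ()
merge-unique {+ (suc x) ∷ c}  {+ zero ∷ c′}     l l′ () q
merge-unique {+ (suc x) ∷ c}  {+ (suc y) ∷ c′}  l l′ p q with ∷-injectiveˡ p
... | refl = cong (+ (suc x) ∷_) (merge-unique (Linked.tail l) (Linked.tail l′) (∷-injectiveʳ p) q)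
merge-unique {+ (suc x) ∷ c}  { -[1+ y ] ∷ c′}  l l′ p q with nonpos-head c l
... | _ , e with trans (sym e) q
... | ()
merge-unique { -[1+ x ] ∷ c}  {+ zero ∷ c′}     l l′ p ()
merge-unique { -[1+ x ] ∷ c}  {+ (suc y) ∷ c′}  l l′ p q with nonpos-head c′ l′
... | _ , e with trans q e
... | ()
merge-unique { -[1+ x ] ∷ c}  { -[1+ y ] ∷ c′}  l l′ p q with ∷-injectiveˡ q
... | refl = cong (-[1+ x ] ∷_) (merge-unique (Linked.tail l) (Linked.tail l′) p (∷-injectiveʳ q))

-- The zeros locate the middle of `symm c`. Half of them belong to each side, and the left side ends
-- with a 0 by `nonpos-head`, so the cut comes right after the last zero of the first half of them.
symm-injective : ∀ {c c′} → Core c → Core c′ → symm c ≡ symm c′ → c ≡ c′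
symm-injective {c} {c′} l l′ e with nonpos-head c l | nonpos-head c′ l′
... | u , eu | u′ , eu′ = merge-unique (Linked.tail l) (Linked.tail l′) (proj₂ parts)
        (trans eu (trans (cong (0 ∷_) (reverse-injective (proj₁ parts))) (sym eu′)))
  where
  open ≡-Reasoning
  zeros≡ : zeros (nonneg c) ≡ zeros (nonneg c′)
  zeros≡ = ℕ.*-cancelˡ-≡ _ _ 2 (trans (sym (zeros-symm c)) (trans (cong zeros e) (zeros-symm c′)))
  zeros-init : ∀ {a w} → nonpos a ≡ 0 ∷ w → suc (zeros (reverse w)) ≡ zeros (nonneg a)
  zeros-init {a} {w} eq = begin
    suc (zeros (w ʳ++ []))  ≡⟨ cong suc (zeros-ʳ++ w []) ⟩
    suc (zeros w + 0)       ≡⟨ cong suc (ℕ.+-identityʳ _) ⟩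
    zeros (0 ∷ w)           ≡⟨ cong zeros eq ⟨
    zeros (nonpos a)        ≡⟨ zeros-nonpos a ⟩
    zeros (nonneg a) ∎
  symm-split : ∀ {a w} → nonpos a ≡ 0 ∷ w → symm a ≡ reverse w ++ 0 ∷ nonneg a
  symm-split {a} {w} eq = trans (cong (_ʳ++ nonneg a) eq) (ʳ++-defn w)
  parts : reverse u ≡ reverse u′ × nonneg c ≡ nonneg c′
  parts = split-unique (reverse u) (reverse u′)
    (trans (sym (symm-split {c} eu)) (trans e (symm-split {c′} eu′)))
    (ℕ.suc-injective (trans (zeros-init {c} eu) (trans zeros≡ (sym (zeros-init {c′} eu′)))))

-- The vector with positive parts given by the first forest and negative
-- parts by the second, each tree contributing the entries around one 0.
vector : List Tree → List Tree → List ℤ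
vector (node as ∷ f) (node bs ∷ g) =
  map (λ x → + (suc x)) (depths as) ++ + 0 ∷ map -[1+_] (reverse (depths bs)) ++ vector f g
vector _ _ = []

nonneg-map⁺ : ∀ l → nonneg (map (λ x → + (suc x)) l) ≡ map suc l
nonneg-map⁺ []      = refl
nonneg-map⁺ (x ∷ l) = cong (suc x ∷_) (nonneg-map⁺ l)

nonneg-map⁻ : ∀ l → nonneg (map -[1+_] l) ≡ []
nonneg-map⁻ []      = refl
nonneg-map⁻ (x ∷ l) = nonneg-map⁻ l

nonpos-map⁺ : ∀ l → nonpos (map (λ x → + (suc x)) l) ≡ []
nonpos-map⁺ []      = refl
nonpos-map⁺ (x ∷ l) = nonpos-map⁺ l

nonpos-map⁻ : ∀ l → nonpos (map -[1+_] l) ≡ map suc l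
nonpos-map⁻ []      = refl
nonpos-map⁻ (x ∷ l) = cong (suc x ∷_) (nonpos-map⁻ l)

nonneg-vector : ∀ f g → length f ≡ length g → nonneg (vector f g) ≡ depths f
nonneg-vector []            []            _ = refl
nonneg-vector (node as ∷ f) (node bs ∷ g) e = begin
  nonneg (map (λ x → + (suc x)) (depths as) ++ + 0 ∷ B ++ vector f g)
    ≡⟨ nonneg-++ (map (λ x → + (suc x)) (depths as)) _ ⟩
  nonneg (map (λ x → + (suc x)) (depths as)) ++ 0 ∷ nonneg (B ++ vector f g)
    ≡⟨ cong₂ (λ u v → u ++ 0 ∷ v) (nonneg-map⁺ (depths as)) (nonneg-++ B _) ⟩
  map suc (depths as) ++ 0 ∷ nonneg B ++ nonneg (vector f g)
    ≡⟨ cong₂ (λ u v → map suc (depths as) ++ 0 ∷ u ++ v)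
             (nonneg-map⁻ (reverse (depths bs))) (nonneg-vector f g (ℕ.suc-injective e)) ⟩
  depths (node as ∷ f) ∎
  where
  open ≡-Reasoning
  B = map -[1+_] (reverse (depths bs))

nonpos-vector : ∀ f g → length f ≡ length g → nonpos (vector f g) ≡ reverse (depths (reverse g))
nonpos-vector []            []            _ = refl
nonpos-vector (node as ∷ f) (node bs ∷ g) e = begin
  nonpos (map (λ x → + (suc x)) (depths as) ++ + 0 ∷ B ++ vector f g)
    ≡⟨ nonpos-++ (map (λ x → + (suc x)) (depths as)) _ ⟩
  nonpos (map (λ x → + (suc x)) (depths as)) ++ 0 ∷ nonpos (B ++ vector f g)
    ≡⟨ cong₂ (λ u v → u ++ 0 ∷ v) (nonpos-map⁺ (depths as)) (nonpos-++ B _) ⟩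
  0 ∷ nonpos B ++ nonpos (vector f g)
    ≡⟨ cong₂ (λ u v → 0 ∷ u ++ v)
             (trans (nonpos-map⁻ (reverse (depths bs))) (reverse-map suc (depths bs)))
             (nonpos-vector f g (ℕ.suc-injective e)) ⟩
  0 ∷ reverse (map suc (depths bs)) ++ reverse (depths (reverse g))
    ≡⟨ cong (_++ reverse (depths (reverse g))) (reverse-++ (map suc (depths bs)) [ 0 ]) ⟨
  reverse (depths [ node bs ]) ++ reverse (depths (reverse g))
    ≡⟨ reverse-++ (depths (reverse g)) (depths [ node bs ]) ⟨
  reverse (depths (reverse g) ++ depths [ node bs ])
    ≡⟨ cong reverse (depths-++ (reverse g) [ node bs ]) ⟨
  reverse (depths (reverse g ++ [ node bs ]))
    ≡⟨ cong (λ u → reverse (depths u)) (reverse-++ [ node bs ] g) ⟨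
  reverse (depths (reverse (node bs ∷ g))) ∎
  where
  open ≡-Reasoning
  B = map -[1+_] (reverse (depths bs))

symm-vector : ∀ f g → length f ≡ length g → symm (vector f g) ≡ depths (reverse g ++ f)
symm-vector f g e = begin
  nonpos (vector f g) ʳ++ nonneg (vector f g)
    ≡⟨ cong₂ _ʳ++_ (nonpos-vector f g e) (nonneg-vector f g e) ⟩
  reverse (depths (reverse g)) ʳ++ depths f
    ≡⟨ ʳ++-defn (reverse (depths (reverse g))) ⟩
  reverse (reverse (depths (reverse g))) ++ depths f
    ≡⟨ cong (_++ depths f) (reverse-involutive (depths (reverse g))) ⟩
  depths (reverse g) ++ depths f
    ≡⟨ depths-++ (reverse g) f ⟨
  depths (reverse g ++ f) ∎
  where open ≡-Reasoning

⇘-nonneg : ∀ x y → x ℤ.≤ 1ℤ → x ⇘ + y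
⇘-nonneg x y p = ℤ.≤-trans p (+≤+ (s≤s z≤n))

Linked-positive : ∀ {l c} → Postorder l → Linked _⇘_ (+ 0 ∷ c) →
                  ∀ x → x ℤ.≤ 1ℤ → Linked _⇘_ (x ∷ map (λ y → + (suc y)) l ++ + 0 ∷ c)
Linked-positive {l} {c} p q x x≤1 = cons l (go p)
  where
  cons : ∀ l → Linked _⇘_ (map (λ y → + (suc y)) l ++ + 0 ∷ c) →
         Linked _⇘_ (x ∷ map (λ y → + (suc y)) l ++ + 0 ∷ c)
  cons []      r = ⇘-nonneg x _ x≤1 ∷ r
  cons (_ ∷ _) r = ⇘-nonneg x _ x≤1 ∷ r
  go : ∀ {l} → Postorder l → Linked _⇘_ (map (λ y → + (suc y)) l ++ + 0 ∷ c)
  go []                    = q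
  go {y ∷ []}     (b ∷ p′) = +≤+ (s≤s b) ∷ go p′
  go {y ∷ z ∷ l}  (b ∷ p′) = +≤+ (s≤s b) ∷ go p′

-- `ℤ.- + bound l` is the final entry of the block in front of `c`: the 0 itself if `l` is empty,
-- and otherwise the negative entry made from the head of `l`, which `reverse` puts last.
Linked-negative : ∀ {l c} → Postorder l → Linked _⇘_ (ℤ.- + bound l ∷ c) →
                  Linked _⇘_ (+ 0 ∷ map -[1+_] (reverse l) ++ c)
Linked-negative []                    q = q
Linked-negative {y ∷ l} {c} (b ∷ p) q =
  subst (λ u → Linked _⇘_ (+ 0 ∷ u)) word (Linked-negative p (step l b ∷ q))
  where
  step : ∀ l → y ≤ bound l → (ℤ.- + bound l) ⇘ -[1+ y ]
  step []      z≤n     = +≤+ z≤n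
  step (z ∷ l) y≤      = ge y y≤
    where
    ge : ∀ y → y ≤ suc z → -[1+ z ] ⇘ -[1+ y ]
    ge zero    _       = -≤+
    ge (suc y) (s≤s p) = -≤- p
  word : map -[1+_] (reverse l) ++ -[1+ y ] ∷ c ≡ map -[1+_] (reverse (y ∷ l)) ++ c
  word = begin
    map -[1+_] (reverse l) ++ [ -[1+ y ] ] ++ c ≡⟨ ++-assoc (map -[1+_] (reverse l)) [ -[1+ y ] ] c ⟨
    (map -[1+_] (reverse l) ++ [ -[1+ y ] ]) ++ c ≡⟨ cong (_++ c) (map-++ -[1+_] (reverse l) [ y ]) ⟨
    map -[1+_] (reverse l ++ [ y ]) ++ c ≡⟨ cong (λ u → map -[1+_] u ++ c) (unfold-reverse y l) ⟨
    map -[1+_] (reverse (y ∷ l)) ++ c ∎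
    where open ≡-Reasoning

-- The value 1 of `x` is wanted at the front of a `Core`, where a first block must exist because -1
-- may not follow 1. Inside the vector, `x` is the final entry of the preceding block and is at most
-- 0.
Linked-vector : ∀ f g → length f ≡ length g → ∀ x → x ℤ.≤ 0ℤ ⊎ (x ℤ.≤ 1ℤ × 0 < length f) →
                Linked _⇘_ (x ∷ vector f g ++ [ -1ℤ ])
Linked-vector []            []            e x (inj₁ x≤0)      = x≤0 ∷ [-]
Linked-vector []            []            e x (inj₂ (_ , ()))
Linked-vector (node as ∷ f) (node bs ∷ g) e x h =
  subst (λ u → Linked _⇘_ (x ∷ u)) word
    (Linked-positive (Postorder-depths as)
      (Linked-negative (Postorder-depths bs)
        (Linked-vector f g (ℕ.suc-injective e) _ (inj₁ ℤ.neg-≤-pos)))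
      x (x≤1 h))
  where
  x≤1 : x ℤ.≤ 0ℤ ⊎ (x ℤ.≤ 1ℤ × 0 < length (node as ∷ f)) → x ℤ.≤ 1ℤ
  x≤1 (inj₁ p)       = ℤ.≤-trans p (+≤+ z≤n)
  x≤1 (inj₂ (p , _)) = p
  word : _ ≡ vector (node as ∷ f) (node bs ∷ g) ++ [ -1ℤ ]
  word = trans (cong (λ u → map (λ y → + (suc y)) (depths as) ++ + 0 ∷ u)
                     (sym (++-assoc (map -[1+_] (reverse (depths bs))) (vector f g) _)))
               (sym (++-assoc (map (λ y → + (suc y)) (depths as)) _ _))

Core-vector : ∀ f g → length f ≡ length g → 0 < length f → Core (vector f g)
Core-vector f g e p = Linked-vector f g e (+ 1) (inj₂ (ℤ.≤-refl , p))

-- Letter counts and the words of core vectors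

countN-ʳ++ : ∀ w w′ → countN (w ʳ++ w′) ≡ countN w + countN w′
countN-ʳ++ []       w′ = refl
countN-ʳ++ (N ∷ w)  w′ = trans (countN-ʳ++ w (N ∷ w′)) (ℕ.+-suc (countN w) (countN w′))
countN-ʳ++ (E ∷ w)  w′ = countN-ʳ++ w (E ∷ w′)
countN-ʳ++ (E⁺ ∷ w) w′ = countN-ʳ++ w (E⁺ ∷ w′)
countN-ʳ++ (E⁻ ∷ w) w′ = countN-ʳ++ w (E⁻ ∷ w′)

countN-reverse : ∀ w → countN (reverse w) ≡ countN w
countN-reverse w = trans (countN-ʳ++ w []) (ℕ.+-identityʳ (countN w))

count-length : ∀ w → countN w + countEast w ≡ length w
count-length []       = refl
count-length (N ∷ w)  = cong suc (count-length w)
count-length (E ∷ w)  = trans (ℕ.+-suc (countN w) _) (cong suc (count-length w))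
count-length (E⁺ ∷ w) = trans (ℕ.+-suc (countN w) _) (cong suc (count-length w))
count-length (E⁻ ∷ w) = trans (ℕ.+-suc (countN w) _) (cong suc (count-length w))

countEast-reverse : ∀ w → countEast (reverse w) ≡ countEast w
countEast-reverse w = ℕ.+-cancelˡ-≡ (countN w) _ _ (begin
  countN w + countEast (reverse w)           ≡⟨ cong (_+ countEast (reverse w)) (countN-reverse w) ⟨
  countN (reverse w) + countEast (reverse w) ≡⟨ count-length (reverse w) ⟩
  length (reverse w)                         ≡⟨ length-reverse w ⟩
  length w                                   ≡⟨ count-length w ⟨
  countN w + countEast w ∎)
  where open ≡-Reasoning

All-reverse : ∀ {A : Set} {P : A → Set} {xs} → All P xs → All P (reverse xs)
All-reverse {P = P} pxs = go pxs []
  where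
  go : ∀ {xs ys} → All P xs → All P ys → All P (xs ʳ++ ys)
  go []         pys = pys
  go (px ∷ pxs) pys = go pxs (px ∷ pys)

Run-plain : ∀ {r Q P} → Run r Q P → All Plain r
Run-plain start       = []
Run-plain (north a _) = inj₁ refl ∷ Run-plain a
Run-plain (east a _)  = inj₂ refl ∷ Run-plain a

Run-ballot : ∀ {w Q P} → Run (reverse w) Q P → Ballot w
Run-ballot {w} a p q e
  with Run-suffix (reverse q) {reverse p} (subst (λ u → Run u _ _) (trans (cong reverse (sym e)) (reverse-++ p q)) a)
... | Q′ , P′ , b = subst₂ _≤_ (countEast-reverse p) (countN-reverse p)
        (subst (countEast (reverse p) ≤_) (Run-height b) (ℕ.m≤m+n _ (length Q′)))

dropLast-∷ʳ : ∀ w x → dropLast (w ++ [ x ]) ≡ w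
dropLast-∷ʳ []          x = refl
dropLast-∷ʳ (_ ∷ [])    x = refl
dropLast-∷ʳ (y ∷ z ∷ w) x = cong (y ∷_) (dropLast-∷ʳ (z ∷ w) x)

word : List ℤ → List Step
word c = levels (2 * length c) (symm c)

zeros≤length : ∀ a → zeros (nonneg a) ≤ length a
zeros≤length []              = z≤n
zeros≤length (+ zero ∷ a)    = s≤s (zeros≤length a)
zeros≤length (+ (suc x) ∷ a) = ℕ.m≤n⇒m≤1+n (zeros≤length a)
zeros≤length (-[1+ x ] ∷ a)  = ℕ.m≤n⇒m≤1+n (zeros≤length a)

length-symm≤ : ∀ a → length (symm a) ≤ 2 * length a
length-symm≤ a = subst₂ _≤_ (sym (length-symm a)) (cong (λ u → length a + u) (sym (ℕ.+-identityʳ _)))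
  (ℕ.+-monoʳ-≤ (length a) (zeros≤length a))

-- The `2 * length a` levels reach every node: a postorder entry is smaller than the number of
-- entries, and symmetrising at most doubles that number.
Run-depths : ∀ {f a} → depths f ≡ symm a → Run (reverse (word a)) f []
Run-depths {f} {a} e = subst (λ u → Run (reverse u) f [])
  (cong (levels (2 * length a)) e)
  (Run-levels (2 * length a) f
    (All.map (λ p → ℕ.<-≤-trans p (subst (λ u → length u ≤ 2 * length a) (sym e) (length-symm≤ a)))
      (Postorder-< (Postorder-depths f))))

-- The machine stops with no children pending and a nonempty queue, so its last letter was `N`.
-- Deleting the last letter therefore loses no information.
word-∷ʳ : ∀ {c} → Core c → word c ≡ dropLast (word c) ++ [ N ]
word-∷ʳ {c} co with forest (Postorder-symm co) | nonpos-head c co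
... | f , e | u , eu = go (reverse (word c)) (reverse-involutive (word c)) (Run-depths {f} {c} e) ne
  where
  go : ∀ r → reverse r ≡ word c → Run r f [] → f ≢ [] → word c ≡ dropLast (word c) ++ [ N ]
  go (N ∷ r) q (north _ _) _ = trans (sym eq) (cong (_++ [ N ])
    (trans (sym (dropLast-∷ʳ (reverse r) N)) (cong dropLast eq)))
    where
    eq : reverse r ++ [ N ] ≡ word c
    eq = trans (sym (unfold-reverse N r)) q
  go .(E ∷ _) q (east {P = P} _ x) _ = ⊥-elim (snoc≢[] P x)
  go .[] q start ne′ = ⊥-elim (ne′ refl)
  ne : f ≢ []
  ne refl with trans (cong zeros e) (trans (zeros-ʳ++ (nonpos c) (nonneg c)) (cong (λ v → zeros v + zeros (nonneg c)) eu))
  ... | ()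

word-injective : ∀ {c c′} → Core c → Core c′ →
                 dropLast (word c) ≡ dropLast (word c′) → c ≡ c′
word-injective {c} {c′} co co′ e with forest (Postorder-symm co) | forest (Postorder-symm co′)
... | f , df | f′ , df′ = symm-injective co co′ (trans (sym df) (trans (cong depths f≡f′) df′))
  where
  w≡w′ : word c ≡ word c′
  w≡w′ = trans (word-∷ʳ co) (trans (cong (_++ [ N ]) e) (sym (word-∷ʳ co′)))
  f≡f′ : f ≡ f′
  f≡f′ = proj₁ (Run-functional (Run-depths {f} {c} df)
    (subst (λ u → Run (reverse u) f′ []) (sym w≡w′) (Run-depths {f′} {c′} df′)))

record WordCounts (c : List ℤ) : Set where
  field
    ballot : Ballot (word c)
    plain  : All Plain (word c)
    norths : countN (word c) ≡ length c + zeros (nonneg c)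
    len    : length (word c) ≡ 2 * length c

-- Let `z` be the number of zeros of `c`. The forest has `length c + z` nodes, one per `N`, and
-- `2 * z` roots, which is the excess of `N` over `E`; in the total length the two contributions of
-- `z` cancel.
wordCounts : ∀ {c} → Core c → WordCounts c
wordCounts {c} co with forest (Postorder-symm co)
... | f , e = record
  { ballot = Run-ballot run
  ; plain  = subst (All Plain) (reverse-involutive (word c)) (All-reverse (Run-plain run))
  ; norths = norths
  ; len    = ℕ.+-cancelʳ-≡ (length f) _ _ len′
  }
  where
  open ≡-Reasoning
  run : Run (reverse (word c)) f []
  run = Run-depths {f} {c} e
  z = zeros (nonneg c)
  norths : countN (word c) ≡ length c + z
  norths = begin
    countN (word c)           ≡⟨ countN-reverse (word c) ⟨
    countN (reverse (word c)) ≡⟨ Run-countN run ⟩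
    size f + 0                ≡⟨ ℕ.+-identityʳ _ ⟩
    length (depths f)         ≡⟨ cong length e ⟩
    length (symm c)           ≡⟨ length-symm c ⟩
    length c + z ∎
  roots : length f ≡ 2 * z
  roots = trans (sym (zeros-depths f)) (trans (cong zeros e) (zeros-symm c))
  height : countEast (word c) + length f ≡ countN (word c)
  height = subst₂ (λ a b → a + length f ≡ b) (countEast-reverse (word c)) (countN-reverse (word c)) (Run-height run)
  rearrange : ∀ a b → a + b + (a + b) ≡ 2 * a + 2 * b
  rearrange = ℕ-Ring.solve-∀
  len′ : length (word c) + length f ≡ 2 * length c + length f
  len′ = begin
    length (word c) + length f                       ≡⟨ cong (_+ length f) (count-length (word c)) ⟨
    countN (word c) + countEast (word c) + length f  ≡⟨ ℕ.+-assoc (countN (word c)) _ _ ⟩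
    countN (word c) + (countEast (word c) + length f) ≡⟨ cong₂ _+_ norths (trans height norths) ⟩
    length c + z + (length c + z)                    ≡⟨ rearrange (length c) z ⟩
    2 * length c + 2 * z                             ≡⟨ cong (λ u → 2 * length c + u) roots ⟨
    2 * length c + length f ∎

halves : ∀ {A : Set} z (xs : List A) → length xs ≡ 2 * z →
         ∃₂ λ ys zs → xs ≡ ys ++ zs × length ys ≡ z × length zs ≡ z
halves z xs e = take z xs , drop z xs , sym (take++drop≡id z xs) ,
  trans (length-take z xs) (ℕ.m≤n⇒m⊓n≡m (subst (z ≤_) (sym e) (ℕ.m≤m+n z _))) ,
  trans (length-drop z xs) (trans (cong (_∸ z) e) (trans (ℕ.m+n∸m≡n z (z + 0)) (ℕ.+-identityʳ z)))

-- The deleted `N` is restored and the machine run. Its word has even length, so the number of trees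
-- left is even; the first half of them supplies the nonpositive entries, in reverse order, and the
-- second half the nonnegative ones.
word-surjective : ∀ n w → length w ≡ 2 * suc n ∸ 1 → All Plain w → Ballot w →
                  ∃ λ c → Core c × length c ≡ suc n × dropLast (word c) ≡ w
word-surjective n w len plain ballot
  with Run-exists (reverse w) (All-reverse plain)
         (λ r₁ r₂ e → subst₂ _≤_ (countEast-reverse r₂) (countN-reverse r₂)
            (ballot (reverse r₂) (reverse r₁)
              (trans (sym (reverse-++ r₁ r₂)) (trans (cong reverse e) (reverse-involutive w)))))
... | Q₀ , P₀ , run₀ = result
  where
  open ≡-Reasoning
  Q : List Tree
  Q = Q₀ ++ [ node P₀ ]
  r : List Step
  r = N ∷ reverse w
  run : Run r Q []
  run = north run₀ refl
  z : ℕ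
  -- Half the number of trees: the wanted vector has `suc n` entries, and symmetrising adds one node
  -- for each of its zeros.
  z = size Q ∸ suc n
  len-r : length r ≡ 2 * suc n
  len-r = cong suc (trans (length-reverse w) len)
  double : 2 * suc n + length Q ≡ 2 * size Q
  double = begin
    2 * suc n + length Q              ≡⟨ cong (_+ length Q) len-r ⟨
    length r + length Q               ≡⟨ cong (_+ length Q) (count-length r) ⟨
    countN r + countEast r + length Q ≡⟨ ℕ.+-assoc (countN r) _ _ ⟩
    countN r + (countEast r + length Q) ≡⟨ cong (λ u → countN r + u) (Run-height run) ⟩
    countN r + countN r               ≡⟨ cong₂ _+_ norths (trans norths (sym (ℕ.+-identityʳ _))) ⟩
    2 * size Q ∎
    where
    norths : countN r ≡ size Q
    norths = trans (Run-countN run) (ℕ.+-identityʳ _)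
  size≡ : suc n + z ≡ size Q
  size≡ = ℕ.m+[n∸m]≡n {suc n} (ℕ.*-cancelˡ-≤ 2 (subst (2 * suc n ≤_) double (ℕ.m≤m+n _ _)))
  roots : length Q ≡ 2 * z
  roots = ℕ.+-cancelˡ-≡ (2 * suc n) _ _
    (trans double (trans (cong (2 *_) (sym size≡)) (ℕ.*-distribˡ-+ 2 (suc n) z)))
  positive : ∀ z → length Q ≡ 2 * z → 0 < z
  positive zero    e with trans (sym (trans (length-++ Q₀) (ℕ.+-comm (length Q₀) 1))) e
  ... | ()
  positive (suc _) _ = s≤s z≤n
  result : ∃ λ c → Core c × length c ≡ suc n × dropLast (word c) ≡ w
  result with halves z Q roots
  ... | g , f , Q≡ , lg , lf = c , Core-vector f (reverse g) lengths (subst (0 <_) (sym lf) (positive z roots)) , len-c ,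
        trans (cong dropLast word≡) (dropLast-∷ʳ w N)
    where
    c = vector f (reverse g)
    lengths : length f ≡ length (reverse g)
    lengths = trans lf (sym (trans (length-reverse g) lg))
    depths≡ : depths Q ≡ symm c
    depths≡ = trans (cong depths (trans Q≡ (cong (_++ f) (sym (reverse-involutive g)))))
      (sym (symm-vector f (reverse g) lengths))
    len-c : length c ≡ suc n
    len-c = ℕ.+-cancelʳ-≡ z _ _ (begin
      length c + z                  ≡⟨ cong (λ u → length c + u) (trans (sym lf) (trans (sym (zeros-depths f)) (cong zeros (sym (nonneg-vector f (reverse g) lengths))))) ⟩
      length c + zeros (nonneg c)   ≡⟨ length-symm c ⟨
      length (symm c)               ≡⟨ cong length depths≡ ⟨
      size Q                        ≡⟨ size≡ ⟨
      suc n + z ∎)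
    word≡ : word c ≡ w ++ [ N ]
    word≡ = begin
      word c                     ≡⟨ reverse-involutive (word c) ⟨
      reverse (reverse (word c)) ≡⟨ cong reverse (Run-injective (Run-depths {Q} {c} depths≡) run) ⟩
      reverse (N ∷ reverse w)    ≡⟨ unfold-reverse N (reverse w) ⟩
      reverse (reverse w) ++ [ N ] ≡⟨ cong (_++ [ N ]) (reverse-involutive w) ⟩
      w ++ [ N ] ∎

-- Reflection of the last entry and position of the sign

symm-negate-head : ∀ x a → symm (ℤ.- + x ∷ a) ≡ symm (+ x ∷ a)
symm-negate-head zero    a = refl
symm-negate-head (suc x) a = refl

ʳ++-assoc : ∀ {A : Set} (xs : List A) {ys zs} → (xs ʳ++ ys) ++ zs ≡ xs ʳ++ (ys ++ zs)
ʳ++-assoc []       = refl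
ʳ++-assoc (x ∷ xs) = ʳ++-assoc xs

symm-∷ʳ : ∀ a x → symm (a ++ [ x ]) ≡ nonpos [ x ] ++ symm a ++ nonneg [ x ]
symm-∷ʳ a x = begin
  nonpos (a ++ [ x ]) ʳ++ nonneg (a ++ [ x ])         ≡⟨ cong₂ _ʳ++_ (nonpos-++ a [ x ]) (nonneg-++ a [ x ]) ⟩
  (nonpos a ++ nonpos [ x ]) ʳ++ nonneg a ++ nonneg [ x ] ≡⟨ ++-ʳ++ (nonpos a) ⟩
  nonpos [ x ] ʳ++ nonpos a ʳ++ nonneg a ++ nonneg [ x ]  ≡⟨ cong (nonpos [ x ] ʳ++_) (ʳ++-assoc (nonpos a)) ⟨
  nonpos [ x ] ʳ++ symm a ++ nonneg [ x ]              ≡⟨ single x ⟩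
  nonpos [ x ] ++ symm a ++ nonneg [ x ] ∎
  where
  open ≡-Reasoning
  single : ∀ x {u} → nonpos [ x ] ʳ++ u ≡ nonpos [ x ] ++ u
  single (+ zero)    = refl
  single (+ (suc _)) = refl
  single -[1+ _ ]    = refl

letter-empty : ∀ {M k} → k < M → letter M k ≡ []
letter-empty {suc M} {zero}  p       = refl
letter-empty {suc M} {suc k} (s≤s p) = letter-empty p

-- Since letter (j + 1) (k + 1) = letter j k, the letters of a final k + 1 in
-- level j + 1 can be read as those of an initial k in level j.
levels-rotate : ∀ l k M → letter M (suc k) ++ levels M (l ++ [ suc k ]) ≡ levels M (k ∷ l) ++ letter 0 (suc k)
levels-rotate l k zero    = ++-identityʳ _
levels-rotate l k (suc M) = begin
  letter M k ++ level M (l ++ [ suc k ]) ++ levels M (l ++ [ suc k ])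
    ≡⟨ cong (λ u → letter M k ++ u ++ levels M (l ++ [ suc k ]))
            (trans (level-++ M l [ suc k ]) (cong (level M l ++_) (++-identityʳ _))) ⟩
  letter M k ++ (level M l ++ letter M (suc k)) ++ levels M (l ++ [ suc k ])
    ≡⟨ cong (letter M k ++_) (++-assoc (level M l) _ _) ⟩
  letter M k ++ level M l ++ letter M (suc k) ++ levels M (l ++ [ suc k ])
    ≡⟨ cong (λ u → letter M k ++ level M l ++ u) (levels-rotate l k M) ⟩
  letter M k ++ level M l ++ levels M (k ∷ l) ++ letter 0 (suc k)
    ≡⟨ trans (cong (_++ letter 0 (suc k)) (++-assoc (letter M k) (level M l) _))
             (trans (++-assoc (letter M k) _ _) (cong (letter M k ++_) (++-assoc (level M l) _ _))) ⟨
  (level M (k ∷ l) ++ levels M (k ∷ l)) ++ letter 0 (suc k) ∎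
  where open ≡-Reasoning

levels-∷ʳ0 : ∀ l M → levels (suc M) (l ++ [ 0 ]) ≡ levels (suc M) l ++ [ N ]
levels-∷ʳ0 l zero    = trans (++-identityʳ _) (trans (level-++ 0 l [ 0 ]) (cong (_++ [ N ]) (sym (++-identityʳ _))))
levels-∷ʳ0 l (suc M) = trans (cong₂ _++_ (trans (level-++ (suc M) l [ 0 ]) (++-identityʳ _)) (levels-∷ʳ0 l M))
  (sym (++-assoc (level (suc M) l) _ _))

-- After the rotation the two words can differ only in `letter 0 (suc k)`, which is empty unless `k`
-- is 0. In that case it is a final `E` facing the final `N` of an entry 0, and this letter is
-- deleted. The bound on `k` ensures that nothing is left over at the front.
dropLast-reflect : ∀ M a k → suc k < M →
  dropLast (levels M (symm (a ++ [ + (suc k) ]))) ≡ dropLast (levels M (symm (a ++ [ ℤ.- + k ])))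
dropLast-reflect (suc M) a k k<M = trans (cong (λ u → dropLast (levels (suc M) u)) (symm-∷ʳ a (+ (suc k))))
  (trans (cong dropLast rotate) (go k))
  where
  rotate : levels (suc M) (symm a ++ [ suc k ]) ≡ levels (suc M) (k ∷ symm a) ++ letter 0 (suc k)
  rotate = trans (cong (_++ levels (suc M) (symm a ++ [ suc k ])) (sym (letter-empty k<M)))
    (levels-rotate (symm a) k (suc M))
  go : ∀ k → dropLast (levels (suc M) (k ∷ symm a) ++ letter 0 (suc k))
             ≡ dropLast (levels (suc M) (symm (a ++ [ ℤ.- + k ])))
  go zero    = trans (dropLast-∷ʳ (levels (suc M) (0 ∷ symm a)) E)
    (sym (trans (cong dropLast (trans (cong (levels (suc M)) (symm-∷ʳ a (+ 0))) (levels-∷ʳ0 (0 ∷ symm a) M)))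
                (dropLast-∷ʳ (levels (suc M) (0 ∷ symm a)) N)))
  go (suc k) = cong dropLast (trans (++-identityʳ _)
    (cong (levels (suc M)) (sym (trans (symm-∷ʳ a -[1+ k ]) (cong (suc k ∷_) (++-identityʳ (symm a)))))))

dropLast-++ : ∀ w x v → dropLast (w ++ x ∷ v) ≡ w ++ dropLast (x ∷ v)
dropLast-++ []          x v = refl
dropLast-++ (y ∷ [])    x v = refl
dropLast-++ (y ∷ z ∷ w) x v = cong (y ∷_) (dropLast-++ (z ∷ w) x v)

countN-++ : ∀ w w′ → countN (w ++ w′) ≡ countN w + countN w′
countN-++ []       w′ = refl
countN-++ (N ∷ w)  w′ = cong suc (countN-++ w w′)
countN-++ (E ∷ w)  w′ = countN-++ w w′
countN-++ (E⁺ ∷ w) w′ = countN-++ w w′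
countN-++ (E⁻ ∷ w) w′ = countN-++ w w′

countN-level₀ : ∀ l → countN (level 0 l) ≡ zeros l
countN-level₀ []                = refl
countN-level₀ (zero ∷ l)        = cong suc (countN-level₀ l)
countN-level₀ (suc zero ∷ l)    = countN-level₀ l
countN-level₀ (suc (suc x) ∷ l) = countN-level₀ l

-- The word up to the place between the halves S⁻← 0 and S⁺→ 0 of the last level.
word-split : ∀ {n c} → Core c → length c ≡ suc n → ∃ λ w →
             word c ≡ w ++ level 0 (reverse (nonpos c)) ++ level 0 (nonneg c)
             × countN (w ++ level 0 (reverse (nonpos c))) ≡ suc n
word-split {n} {c} co len = w , split , ℕ.+-cancelʳ-≡ (zeros (nonneg c)) _ _ count
  where
  open ≡-Reasoning
  M = n + 1 * suc n
  w = concatMap (λ j → level (suc j) (symm c)) (downFrom M)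
  v = level 0 (reverse (nonpos c))
  split : word c ≡ w ++ v ++ level 0 (nonneg c)
  split = begin
    levels (2 * length c) (symm c) ≡⟨ cong (λ u → levels (2 * u) (symm c)) len ⟩
    levels (suc M) (symm c)        ≡⟨ levels-suc (symm c) _ (λ j → refl) M ⟩
    w ++ level 0 (symm c)          ≡⟨ cong (λ u → w ++ level 0 u) (ʳ++-defn (nonpos c)) ⟩
    w ++ level 0 (reverse (nonpos c) ++ nonneg c) ≡⟨ cong (w ++_) (level-++ 0 (reverse (nonpos c)) _) ⟩
    w ++ v ++ level 0 (nonneg c) ∎
  -- The word has `length c + zeros (nonneg c)` letters `N`, and the second summand counts those to
  -- the right of the cut.
  count : countN (w ++ v) + zeros (nonneg c) ≡ suc n + zeros (nonneg c)
  count = begin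
    countN (w ++ v) + zeros (nonneg c)            ≡⟨ cong (λ u → countN (w ++ v) + u) (countN-level₀ (nonneg c)) ⟨
    countN (w ++ v) + countN (level 0 (nonneg c)) ≡⟨ countN-++ (w ++ v) _ ⟨
    countN ((w ++ v) ++ level 0 (nonneg c))       ≡⟨ cong countN (trans (++-assoc w v _) (sym split)) ⟩
    countN (word c)                               ≡⟨ WordCounts.norths (wordCounts co) ⟩
    length c + zeros (nonneg c)                   ≡⟨ cong (_+ zeros (nonneg c)) len ⟩
    suc n + zeros (nonneg c) ∎

signAfter-east : ∀ {m} s p q → countN p ≡ m → signAfter (suc m) s (p ++ N ∷ E ∷ q) ≡ p ++ N ∷ s ∷ q
signAfter-east             s []       q refl = refl
signAfter-east             s (N ∷ p)  q refl = cong (N ∷_) (signAfter-east s p q refl)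
signAfter-east {zero}      s (E ∷ p)  q e = cong (E ∷_) (signAfter-east s p q e)
signAfter-east {suc m}     s (E ∷ p)  q e = cong (E ∷_) (signAfter-east s p q e)
signAfter-east {zero}      s (E⁺ ∷ p) q e = cong (E⁺ ∷_) (signAfter-east s p q e)
signAfter-east {suc m}     s (E⁺ ∷ p) q e = cong (E⁺ ∷_) (signAfter-east s p q e)
signAfter-east {zero}      s (E⁻ ∷ p) q e = cong (E⁻ ∷_) (signAfter-east s p q e)
signAfter-east {suc m}     s (E⁻ ∷ p) q e = cong (E⁻ ∷_) (signAfter-east s p q e)

NoEastHead : List Step → Set
NoEastHead q = ∀ {q′} → q ≢ E ∷ q′

signAfter-fixed : ∀ {m} s p q → countN p ≡ m → NoEastHead q → signAfter (suc m) s (p ++ N ∷ q) ≡ p ++ N ∷ q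
signAfter-fixed         s []       []        refl h = refl
signAfter-fixed         s []       (N ∷ q)   refl h = refl
signAfter-fixed         s []       (E ∷ q)   refl h = ⊥-elim (h refl)
signAfter-fixed         s []       (E⁺ ∷ q)  refl h = refl
signAfter-fixed         s []       (E⁻ ∷ q)  refl h = refl
signAfter-fixed         s (N ∷ p)  q refl h = cong (N ∷_) (signAfter-fixed s p q refl h)
signAfter-fixed {zero}  s (E ∷ p)  q e h = cong (E ∷_) (signAfter-fixed s p q e h)
signAfter-fixed {suc m} s (E ∷ p)  q e h = cong (E ∷_) (signAfter-fixed s p q e h)
signAfter-fixed {zero}  s (E⁺ ∷ p) q e h = cong (E⁺ ∷_) (signAfter-fixed s p q e h)
signAfter-fixed {suc m} s (E⁺ ∷ p) q e h = cong (E⁺ ∷_) (signAfter-fixed s p q e h)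
signAfter-fixed {zero}  s (E⁻ ∷ p) q e h = cong (E⁻ ∷_) (signAfter-fixed s p q e h)
signAfter-fixed {suc m} s (E⁻ ∷ p) q e h = cong (E⁻ ∷_) (signAfter-fixed s p q e h)

-- A first entry 0 is read on both sides of the cut, so the marked `N`, the last one on the left, is
-- followed by another `N`, or by nothing once the last letter is deleted.
signAfter-core-zero : ∀ {n a} s → Core (+ 0 ∷ a) → length a ≡ n →
  signAfter (suc n) s (dropLast (word (+ 0 ∷ a))) ≡ dropLast (word (+ 0 ∷ a))
signAfter-core-zero {n} {a} s co len with word-split {n} co (cong suc len)
... | w , e , count = subst (λ u → signAfter (suc n) s u ≡ u) (sym shape)
    (signAfter-fixed s p (dropLast (N ∷ v)) count′ (noEast v))
  where
  open ≡-Reasoning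
  v = level 0 (nonneg a)
  p = w ++ level 0 (reverse (nonpos a))
  shift-N : w ++ level 0 (reverse (0 ∷ nonpos a)) ≡ p ++ [ N ]
  shift-N = begin
    w ++ level 0 (reverse (0 ∷ nonpos a))        ≡⟨ cong (λ u → w ++ level 0 u) (unfold-reverse 0 (nonpos a)) ⟩
    w ++ level 0 (reverse (nonpos a) ++ [ 0 ])   ≡⟨ cong (w ++_) (level-++ 0 (reverse (nonpos a)) [ 0 ]) ⟩
    w ++ level 0 (reverse (nonpos a)) ++ [ N ]   ≡⟨ ++-assoc w _ _ ⟨
    p ++ [ N ] ∎
  shape : dropLast (word (+ 0 ∷ a)) ≡ p ++ N ∷ dropLast (N ∷ v)
  shape = begin
    dropLast (word (+ 0 ∷ a)) ≡⟨ cong dropLast (trans e (sym (++-assoc w _ _))) ⟩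
    dropLast ((w ++ level 0 (reverse (0 ∷ nonpos a))) ++ N ∷ v) ≡⟨ cong (λ u → dropLast (u ++ N ∷ v)) shift-N ⟩
    dropLast ((p ++ [ N ]) ++ N ∷ v) ≡⟨ dropLast-++ (p ++ [ N ]) N v ⟩
    (p ++ [ N ]) ++ dropLast (N ∷ v) ≡⟨ ++-assoc p _ _ ⟩
    p ++ N ∷ dropLast (N ∷ v) ∎
  count′ : countN p ≡ n
  count′ = ℕ.suc-injective (trans (ℕ.+-comm 1 (countN p))
    (trans (sym (countN-++ p [ N ])) (trans (cong countN (sym shift-N)) count)))
  noEast : ∀ v → NoEastHead (dropLast (N ∷ v))
  noEast []      ()
  noEast (_ ∷ _) ()

-- Only East steps can follow the last `N` of `w`. Hence, if the word goes on with `E` after `w`,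
-- the step right after that `N` is an `E` in any case, as the last component records.
lastNorth : ∀ {m} w → All Plain w → countN w ≡ suc m →
            ∃₂ λ p t → w ≡ p ++ N ∷ t × countN p ≡ m × (∀ v → ∃ λ q → t ++ E ∷ v ≡ E ∷ q)
lastNorth (N ∷ w) (_ ∷ pl) e with countN w in eq
... | suc m with lastNorth w pl eq
...   | p , t , refl , c , h = N ∷ p , t , refl , trans (cong suc c) (ℕ.suc-injective e) , h
lastNorth (N ∷ w) (_ ∷ pl) e | zero = [] , w , refl , ℕ.suc-injective e , easts w pl eq
  where
  easts : ∀ w → All Plain w → countN w ≡ 0 → ∀ v → ∃ λ q → w ++ E ∷ v ≡ E ∷ q
  easts []       _               _ v = v , refl
  easts (E ∷ w)  _               _ v = _ , refl
  easts (E⁺ ∷ w) (inj₁ () ∷ _) _ v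
  easts (E⁺ ∷ w) (inj₂ () ∷ _) _ v
  easts (E⁻ ∷ w) (inj₁ () ∷ _) _ v
  easts (E⁻ ∷ w) (inj₂ () ∷ _) _ v
lastNorth (E ∷ w) (_ ∷ pl) e with lastNorth w pl e
... | p , t , refl , c , h = E ∷ p , t , refl , c , h
lastNorth (E⁺ ∷ w) (inj₁ () ∷ _) e
lastNorth (E⁺ ∷ w) (inj₂ () ∷ _) e
lastNorth (E⁻ ∷ w) (inj₁ () ∷ _) e
lastNorth (E⁻ ∷ w) (inj₂ () ∷ _) e

-- On the way down from a positive entry a 1 comes before the first 0, so the letter `E` comes
-- first. The 0 must follow and yields a further letter, so this `E` is not the one deleted at the
-- end.
level₀-positive : ∀ x a → Linked _⇘_ (+ (suc x) ∷ a ++ [ -1ℤ ]) →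
                  ∃₂ λ y v → level 0 (nonneg (+ (suc x) ∷ a)) ≡ E ∷ y ∷ v
level₀-positive x []                (p ∷ _) with ⇘-zero 0 p
... | ()
level₀-positive x (-[1+ y ] ∷ a)    (p ∷ _) with ⇘-zero y p
... | ()
level₀-positive zero    (+ zero ∷ a) _                 = _ , _ , refl
level₀-positive (suc x) (+ zero ∷ a) (+≤+ (s≤s ()) ∷ _)
level₀-positive zero    (+ (suc y) ∷ a) (_ ∷ l) with level₀-positive y a l
... | _ , _ , e = _ , _ , cong (E ∷_) e
level₀-positive (suc x) (+ (suc y) ∷ a) (_ ∷ l) = level₀-positive y a l

signAfter-core-suc : ∀ {n x a s s′} → Core (+ (suc x) ∷ a) → length a ≡ n →
  signAfter (suc n) s (dropLast (word (+ (suc x) ∷ a))) ≡ signAfter (suc n) s′ (dropLast (word (+ (suc x) ∷ a))) →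
  s ≡ s′
signAfter-core-suc {n} {x} {a} {s} {s′} co len eq
  with word-split {n} co (cong suc len) | level₀-positive x a (Linked.tail co)
... | w , e , count | y , v , e₂
  with lastNorth (w ++ level 0 (reverse (nonpos a))) plain count
  where
  plain : All Plain (w ++ level 0 (reverse (nonpos a)))
  plain = All.++⁻ˡ _ (subst (All Plain) (trans e (sym (++-assoc w _ _))) (WordCounts.plain (wordCounts {+ (suc x) ∷ a} co)))
... | p , t , e₃ , count′ , h with h (dropLast (y ∷ v))
... | q , e₄ = ∷-injectiveˡ (∷-injectiveʳ (++-cancelˡ p _ _
        (trans (sym (signAfter-east s p q count′))
        (trans (subst (λ u → signAfter (suc n) s u ≡ signAfter (suc n) s′ u) shape eq)
               (signAfter-east s′ p q count′)))))
  where
  open ≡-Reasoning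
  shape : dropLast (word (+ (suc x) ∷ a)) ≡ p ++ N ∷ E ∷ q
  shape = begin
    dropLast (word (+ (suc x) ∷ a)) ≡⟨ cong dropLast (trans e (sym (++-assoc w _ _))) ⟩
    dropLast ((w ++ level 0 (reverse (nonpos a))) ++ level 0 (nonneg (+ (suc x) ∷ a)))
      ≡⟨ cong₂ (λ u u′ → dropLast (u ++ u′)) e₃ e₂ ⟩
    dropLast ((p ++ N ∷ t) ++ E ∷ y ∷ v) ≡⟨ dropLast-++ (p ++ N ∷ t) E (y ∷ v) ⟩
    (p ++ N ∷ t) ++ E ∷ dropLast (y ∷ v) ≡⟨ ++-assoc p _ _ ⟩
    p ++ N ∷ t ++ E ∷ dropLast (y ∷ v)   ≡⟨ cong (λ u → p ++ N ∷ u) e₄ ⟩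
    p ++ N ∷ E ∷ q ∎

-- Signed words

Sign : Step → Set
Sign s = s ≡ E⁺ ⊎ s ≡ E⁻

unsign : Step → Step
unsign N = N
unsign _ = E

unsign-sign : ∀ {s} → Sign s → unsign s ≡ E
unsign-sign (inj₁ refl) = refl
unsign-sign (inj₂ refl) = refl

unsign-plain : ∀ {w} → All Plain w → map unsign w ≡ w
unsign-plain []               = refl
unsign-plain (inj₁ refl ∷ pl) = cong (N ∷_) (unsign-plain pl)
unsign-plain (inj₂ refl ∷ pl) = cong (E ∷_) (unsign-plain pl)

plain-unsign : ∀ w → All Plain (map unsign w)
plain-unsign []       = []
plain-unsign (N ∷ w)  = inj₁ refl ∷ plain-unsign w
plain-unsign (E ∷ w)  = inj₂ refl ∷ plain-unsign w
plain-unsign (E⁺ ∷ w) = inj₂ refl ∷ plain-unsign w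
plain-unsign (E⁻ ∷ w) = inj₂ refl ∷ plain-unsign w

countN-unsign : ∀ w → countN (map unsign w) ≡ countN w
countN-unsign []       = refl
countN-unsign (N ∷ w)  = cong suc (countN-unsign w)
countN-unsign (E ∷ w)  = countN-unsign w
countN-unsign (E⁺ ∷ w) = countN-unsign w
countN-unsign (E⁻ ∷ w) = countN-unsign w

countEast-unsign : ∀ w → countEast (map unsign w) ≡ countEast w
countEast-unsign []       = refl
countEast-unsign (N ∷ w)  = countEast-unsign w
countEast-unsign (E ∷ w)  = cong suc (countEast-unsign w)
countEast-unsign (E⁺ ∷ w) = cong suc (countEast-unsign w)
countEast-unsign (E⁻ ∷ w) = cong suc (countEast-unsign w)

Ballot-unsign⁻ : ∀ {w} → Ballot (map unsign w) → Ballot w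
Ballot-unsign⁻ b p q refl = subst₂ _≤_ (countEast-unsign p) (countN-unsign p)
  (b (map unsign p) (map unsign q) (sym (map-++ unsign p q)))

Ballot-unsign⁺ : ∀ {w} → Ballot w → Ballot (map unsign w)
Ballot-unsign⁺ {w} b p q e with split w p e
  where
  split : ∀ w p → p ++ q ≡ map unsign w → ∃₂ λ p′ q′ → p′ ++ q′ ≡ w × map unsign p′ ≡ p
  split w       []      _ = [] , w , refl , refl
  split (x ∷ w) (y ∷ p) e with ∷-injective e
  ... | refl , e′ with split w p e′
  ...   | p′ , q′ , refl , refl = x ∷ p′ , q′ , refl , refl
... | p′ , q′ , e′ , refl = subst₂ _≤_ (sym (countEast-unsign p′)) (sym (countN-unsign p′)) (b p′ q′ e′)

unsign-signAfter : ∀ k {s w} → Sign s → All Plain w → map unsign (signAfter k s w) ≡ w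
unsign-signAfter zero          sg pl                            = unsign-plain pl
unsign-signAfter (suc k)       sg []                            = refl
unsign-signAfter (suc zero)    sg (inj₁ refl ∷ [])              = refl
unsign-signAfter (suc zero)    sg (inj₁ refl ∷ inj₁ refl ∷ pl)  = cong (λ u → N ∷ N ∷ u) (unsign-plain pl)
unsign-signAfter (suc zero)    sg (inj₁ refl ∷ inj₂ refl ∷ pl)  =
  cong (N ∷_) (cong₂ _∷_ (unsign-sign sg) (unsign-plain pl))
unsign-signAfter (suc (suc k)) sg (inj₁ refl ∷ pl) = cong (N ∷_) (unsign-signAfter (suc k) sg pl)
unsign-signAfter (suc zero)    sg (inj₂ refl ∷ pl) = cong (E ∷_) (unsign-signAfter 1 sg pl)
unsign-signAfter (suc (suc k)) sg (inj₂ refl ∷ pl) = cong (E ∷_) (unsign-signAfter (suc (suc k)) sg pl)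

plain-at : ∀ {w} → All Plain w → ∀ p x q → p ++ x ∷ q ≡ w → Plain x
plain-at pl p x q refl with All.++⁻ʳ p pl
... | px ∷ _ = px

at-plain : ∀ w → (∀ p x q → p ++ x ∷ q ≡ w → Plain x) → All Plain w
at-plain []      h = []
at-plain (x ∷ w) h = h [] x w refl ∷ at-plain w (λ p y q e → h (x ∷ p) y q (cong (x ∷_) e))

¬Ends-[] : ∀ {n} → ¬ EndsWithNthNorth n []
¬Ends-[] ([]    , () , _)
¬Ends-[] (_ ∷ _ , () , _)

¬Ends-past : ∀ {y p} → ¬ EndsWithNthNorth 1 (N ∷ y ∷ p)
¬Ends-past ([]     , () , _)
¬Ends-past (N ∷ p′ , e  , ())
¬Ends-past (E ∷ p′ , () , _)
¬Ends-past (E⁺ ∷ p′ , () , _)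
¬Ends-past (E⁻ ∷ p′ , () , _)

Ends-N⁺ : ∀ {k p} → EndsWithNthNorth (suc k) p → EndsWithNthNorth (suc (suc k)) (N ∷ p)
Ends-N⁺ (p′ , e , c) = N ∷ p′ , cong (N ∷_) e , cong suc c

Ends-N⁻ : ∀ {k p} → EndsWithNthNorth (suc (suc k)) (N ∷ p) → EndsWithNthNorth (suc k) p
Ends-N⁻ ([]     , e , ())
Ends-N⁻ (N ∷ p′ , e , c) = p′ , ∷-injectiveʳ e , ℕ.suc-injective c
Ends-N⁻ (E ∷ p′ , () , c)
Ends-N⁻ (E⁺ ∷ p′ , () , c)
Ends-N⁻ (E⁻ ∷ p′ , () , c)

Ends-E⁺ : ∀ {k p} → EndsWithNthNorth (suc k) p → EndsWithNthNorth (suc k) (E ∷ p)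
Ends-E⁺ (p′ , e , c) = E ∷ p′ , cong (E ∷_) e , c

Ends-E⁻ : ∀ {k p} → EndsWithNthNorth (suc k) (E ∷ p) → EndsWithNthNorth (suc k) p
Ends-E⁻ ([]     , () , _)
Ends-E⁻ (N ∷ p′ , () , c)
Ends-E⁻ (E ∷ p′ , e , c) = p′ , ∷-injectiveʳ e , c
Ends-E⁻ (E⁺ ∷ p′ , () , c)
Ends-E⁻ (E⁻ ∷ p′ , () , c)

BallotShape-N : ∀ {k w} → BallotShape (suc k) w → BallotShape (suc (suc k)) (N ∷ w)
BallotShape-N h []      x q e with ∷-injectiveˡ e
... | refl = (λ _ ()) , (λ _ → inj₁ refl)
BallotShape-N h (y ∷ p) x q e with ∷-injective e
... | refl , e′ = (λ en → proj₁ (h p x q e′) (Ends-N⁻ en)) , (λ en → proj₂ (h p x q e′) (λ z → en (Ends-N⁺ z)))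

BallotShape-E : ∀ {k w} → BallotShape (suc k) w → BallotShape (suc k) (E ∷ w)
BallotShape-E {k} h []      x q e with ∷-injectiveˡ e
... | refl = (λ en → ⊥-elim (¬Ends-[] {suc k} en)) , (λ _ → inj₂ refl)
BallotShape-E h (y ∷ p) x q e with ∷-injective e
... | refl , e′ = (λ en → proj₁ (h p x q e′) (Ends-E⁻ en)) , (λ en → proj₂ (h p x q e′) (λ z → en (Ends-E⁺ z)))

BallotShape-last : ∀ {y w} → y ≢ E → All Plain w → BallotShape 1 (N ∷ y ∷ w)
BallotShape-last y≢E pl [] x q e with ∷-injectiveˡ e
... | refl = (λ _ ()) , (λ _ → inj₁ refl)
BallotShape-last y≢E pl (_ ∷ []) x q e with ∷-injective e
... | refl , e′ with ∷-injectiveˡ e′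
...   | refl = (λ _ → y≢E) , (λ en → ⊥-elim (en ([] , refl , refl)))
BallotShape-last y≢E pl (_ ∷ _ ∷ p) x q e with ∷-injective e
... | refl , e′ = (λ en → ⊥-elim (¬Ends-past en)) , (λ _ → plain-at pl p x q (∷-injectiveʳ e′))

BallotShape-signAfter : ∀ k {s w} → Sign s → All Plain w → BallotShape (suc k) (signAfter (suc k) s w)
BallotShape-signAfter k       sg []                [] x q ()
BallotShape-signAfter k       sg []                (_ ∷ _) x q ()
BallotShape-signAfter zero    sg (inj₁ refl ∷ [])  [] x [] refl = (λ _ ()) , (λ _ → inj₁ refl)
BallotShape-signAfter zero    sg (inj₁ refl ∷ [])  (_ ∷ []) x q ()
BallotShape-signAfter zero    sg (inj₁ refl ∷ [])  (_ ∷ _ ∷ _) x q ()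
BallotShape-signAfter zero    sg (inj₁ refl ∷ inj₁ refl ∷ pl) = BallotShape-last (λ ()) pl
BallotShape-signAfter zero    sg (inj₁ refl ∷ inj₂ refl ∷ pl) = BallotShape-last (sign≢E sg) pl
  where
  sign≢E : ∀ {s} → Sign s → s ≢ E
  sign≢E (inj₁ refl) ()
  sign≢E (inj₂ refl) ()
BallotShape-signAfter (suc k) sg (inj₁ refl ∷ pl) = BallotShape-N (BallotShape-signAfter k sg pl)
BallotShape-signAfter zero    sg (inj₂ refl ∷ pl) = BallotShape-E (BallotShape-signAfter 0 sg pl)
BallotShape-signAfter (suc k) sg (inj₂ refl ∷ pl) = BallotShape-E (BallotShape-signAfter (suc k) sg pl)

-- `BallotShape` admits signed steps only where `signAfter` acts, so one sign suffices to recover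
-- the word. When there is no step to sign, `E⁺` is an arbitrary choice.
signAfter-unsign : ∀ k w → BallotShape (suc k) w →
                   ∃ λ s → Sign s × w ≡ signAfter (suc k) s (map unsign w)
signAfter-unsign k       []          h = E⁺ , inj₁ refl , refl
signAfter-unsign zero    (N ∷ [])    h = E⁺ , inj₁ refl , refl
signAfter-unsign zero    (N ∷ x ∷ w) h = go x (proj₁ (h [ N ] x w refl) ([] , refl , refl)) (sym (unsign-plain
    (at-plain w (λ p y q e → proj₂ (h (N ∷ x ∷ p) y q (cong (λ u → N ∷ x ∷ u) e)) ¬Ends-past))))
  where
  go : ∀ x → x ≢ E → w ≡ map unsign w → ∃ λ s → Sign s × N ∷ x ∷ w ≡ signAfter 1 s (map unsign (N ∷ x ∷ w))
  go N  x≢E e = E⁺ , inj₁ refl , cong (λ u → N ∷ N ∷ u) e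
  go E  x≢E e = ⊥-elim (x≢E refl)
  go E⁺ x≢E e = E⁺ , inj₁ refl , cong (λ u → N ∷ E⁺ ∷ u) e
  go E⁻ x≢E e = E⁻ , inj₂ refl , cong (λ u → N ∷ E⁻ ∷ u) e
signAfter-unsign (suc k) (N ∷ w)     h with signAfter-unsign k w
  (λ p x q e → (λ en → proj₁ (h (N ∷ p) x q (cong (N ∷_) e)) (Ends-N⁺ en)) ,
               (λ en → proj₂ (h (N ∷ p) x q (cong (N ∷_) e)) (λ z → en (Ends-N⁻ z))))
... | s , sg , e = s , sg , cong (N ∷_) e
signAfter-unsign k       (E ∷ w)     h with signAfter-unsign k w
  (λ p x q e → (λ en → proj₁ (h (E ∷ p) x q (cong (E ∷_) e)) (Ends-E⁺ en)) ,
               (λ en → proj₂ (h (E ∷ p) x q (cong (E ∷_) e)) (λ z → en (Ends-E⁻ z))))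
signAfter-unsign zero    (E ∷ w)     h | s , sg , e = s , sg , cong (E ∷_) e
signAfter-unsign (suc k) (E ∷ w)     h | s , sg , e = s , sg , cong (E ∷_) e
signAfter-unsign k       (E⁺ ∷ w)    h with proj₂ (h [] E⁺ w refl) (¬Ends-[] {suc k})
... | inj₁ ()
... | inj₂ ()
signAfter-unsign k       (E⁻ ∷ w)    h with proj₂ (h [] E⁻ w refl) (¬Ends-[] {suc k})
... | inj₁ ()
... | inj₂ ()

-- Area vectors

shift : ℕ → List ℕ → List ℤ
shift k []       = []
shift k (p ∷ ps) = (+ p ℤ.- + k) ∷ shift (suc k) ps

length-shift : ∀ k ps → length (shift k ps) ≡ length ps
length-shift k []       = refl
length-shift k (p ∷ ps) = cong suc (length-shift (suc k) ps)

shift-∷ʳ : ∀ k ps p → shift k (ps ++ [ p ]) ≡ shift k ps ++ [ + p ℤ.- + (k + length ps) ]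
shift-∷ʳ k []       p = cong (λ u → [ + p ℤ.- + u ]) (sym (ℕ.+-identityʳ k))
shift-∷ʳ k (x ∷ ps) p = cong ((+ x ℤ.- + k) ∷_) (trans (shift-∷ʳ (suc k) ps p)
  (cong (λ u → shift (suc k) ps ++ [ + p ℤ.- + u ]) (sym (ℕ.+-suc k (length ps)))))

minus-plus : ∀ i k → i ℤ.- k ℤ.+ k ≡ i
minus-plus = ℤ-Ring.solve-∀

plus-minus : ∀ i k → i ≡ i ℤ.+ k ℤ.- k
plus-minus = ℤ-Ring.solve-∀

suc-minus : ∀ j k → 1ℤ ℤ.+ (j ℤ.- (1ℤ ℤ.+ k)) ≡ j ℤ.- k
suc-minus = ℤ-Ring.solve-∀

minus-suc : ∀ k → k ℤ.- (1ℤ ℤ.+ k) ≡ -1ℤ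
minus-suc = ℤ-Ring.solve-∀

pos-injective-minus : ∀ {i j} k → + i ℤ.- + k ≡ + j ℤ.- + k → i ≡ j
pos-injective-minus {i} {j} k e = ℤ.+-injective (trans (sym (minus-plus (+ i) (+ k)))
  (trans (cong (ℤ._+ + k) e) (minus-plus (+ j) (+ k))))

shift-injective : ∀ k ps qs → shift k ps ≡ shift k qs → ps ≡ qs
shift-injective k []       []       e = refl
shift-injective k (p ∷ ps) (q ∷ qs) e = cong₂ _∷_ (pos-injective-minus k (∷-injectiveˡ e))
  (shift-injective (suc k) ps qs (∷-injectiveʳ e))

≤⇒⇘ : ∀ {i j} k → i ≤ j → (+ i ℤ.- + k) ⇘ (+ j ℤ.- + (suc k))
≤⇒⇘ {i} {j} k p = subst (+ i ℤ.- + k ℤ.≤_) (sym (suc-minus (+ j) (+ k))) (ℤ.+-monoˡ-≤ (ℤ.- + k) (+≤+ p))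

⇘⇒≤ : ∀ {i} k y → (+ i ℤ.- + k) ⇘ y → + i ℤ.≤ y ℤ.+ + (suc k)
⇘⇒≤ {i} k y p = subst₂ ℤ._≤_ (minus-plus (+ i) (+ k)) (shuffle y (+ k)) (ℤ.+-monoˡ-≤ (+ k) p)
  where
  shuffle : ∀ Y K → 1ℤ ℤ.+ Y ℤ.+ K ≡ Y ℤ.+ (1ℤ ℤ.+ K)
  shuffle = ℤ-Ring.solve-∀

Linked-shift⁺ : ∀ k ps → Linked _≤_ ps → Linked _⇘_ (shift k ps)
Linked-shift⁺ k []           l       = []
Linked-shift⁺ k (p ∷ [])     l       = [-]
Linked-shift⁺ k (p ∷ q ∷ ps) (r ∷ l) = ≤⇒⇘ k r ∷ Linked-shift⁺ (suc k) (q ∷ ps) l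

-- Undoing the shift turns the condition into weak monotonicity. As the sequence starts at the
-- natural number `i`, all later terms are natural numbers too.
Linked-shift⁻ : ∀ k i c → Linked _⇘_ ((+ i ℤ.- + k) ∷ c) →
                ∃ λ ps → c ≡ shift (suc k) ps × Linked _≤_ (i ∷ ps)
Linked-shift⁻ k i []      l       = [] , refl , [-]
Linked-shift⁻ k i (y ∷ c) (p ∷ l) = step (y ℤ.+ + (suc k)) refl (⇘⇒≤ k y p)
  where
  step : ∀ z → y ℤ.+ + (suc k) ≡ z → + i ℤ.≤ z →
         ∃ λ ps → y ∷ c ≡ shift (suc k) ps × Linked _≤_ (i ∷ ps)
  step (+ j) e (+≤+ i≤j) with trans (plus-minus y (+ (suc k))) (cong (ℤ._- + (suc k)) e)
  ... | y≡ with Linked-shift⁻ (suc k) j c (subst (λ u → Linked _⇘_ (u ∷ c)) y≡ l)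
  ... | ps , e′ , l′ = j ∷ ps , cong₂ _∷_ y≡ e′ , i≤j ∷ l′
  step -[1+ j ] e ()

-- The area vector of the unsigned path with p ∷ ps East steps before its North steps.
area : ℕ → List ℕ → List ℤ
area p ps = + p ∷ shift 1 ps

shift-area : ∀ p ps → shift 0 (p ∷ ps) ≡ area p ps
shift-area p ps = cong (_∷ shift 1 ps) (ℤ.+-identityʳ (+ p))

area-∷ʳ : ∀ p ps → area p (ps ++ [ length ps ]) ≡ area p ps ++ [ -1ℤ ]
area-∷ʳ p ps = cong (+ p ∷_) (trans (shift-∷ʳ 1 ps (length ps))
  (cong (λ u → shift 1 ps ++ [ u ]) (minus-suc (+ length ps))))

-- `length ps` is the total number of East steps. Appended as one more count it bounds the others
-- from above, and the shift turns it into the final -1 of `Core`.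
Core-area : ∀ p ps → Linked _≤_ (p ∷ ps ++ [ length ps ]) → Core (area p ps)
Core-area p ps l = +≤+ (s≤s z≤n) ∷ subst (Linked _⇘_)
  (trans (shift-area p _) (area-∷ʳ p ps)) (Linked-shift⁺ 0 _ l)

Core-area⁻ : ∀ {c} → Core c → ∃₂ λ p ps → c ≡ area p ps × Linked _≤_ (p ∷ ps ++ [ length ps ])
Core-area⁻ {[]}            (+≤+ () ∷ _)
Core-area⁻ { -[1+ zero ] ∷ c }  (+≤+ () ∷ _)
Core-area⁻ { -[1+ suc x ] ∷ c } (() ∷ _)
Core-area⁻ {+ p ∷ c}       (_ ∷ l)
  with Linked-shift⁻ 0 p (c ++ [ -1ℤ ]) (subst (λ u → Linked _⇘_ (u ∷ c ++ [ -1ℤ ])) (sym (ℤ.+-identityʳ (+ p))) l)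
... | ps , e , l′ with initLast ps
...   | [] = ⊥-elim (snoc≢[] c (sym e))
...   | qs ∷ʳ′ q with ∷ʳ-injective c (shift 1 qs) (trans e (shift-∷ʳ 1 qs q))
...     | refl , e′ = p , qs , refl , subst (λ u → Linked _≤_ (p ∷ qs ++ [ u ])) q≡ l′
  where
  q≡ : q ≡ length qs
  q≡ = pos-injective-minus (suc (length qs)) (trans (sym e′) (sym (minus-suc (+ length qs))))

-- The last count r of a signed path and the last count r′ of the unsigned path
-- with the same word, q being the count before them and m the total number of
-- East steps: r - q = x corresponds to r′ - q = min(2x, 2(m - q) + 1 - 2x).
Fold : ℕ → ℕ → ℕ → ℕ → Set
Fold q m r r′ = r + r ≡ q + r′ ⊎ r + r + r′ ≡ suc (m + m) + q

fold : ∀ {q m r} → q ≤ r → r ≤ m → ∃ λ r′ → q ≤ r′ × r′ ≤ m × Fold q m r r′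
fold {q} q≤r r≤m with ℕ.m≤n⇒∃[o]m+o≡n q≤r | ℕ.m≤n⇒∃[o]m+o≡n r≤m
-- Here `a` is `r - q` and `b` is `m - r`. The smaller of `2a` and `2b + 1` never exceeds `a + b`,
-- so `r′` stays below `m`.
... | a , refl | b , refl with ℕ.≤-<-connex a b
... | inj₁ a≤b = q + a + a , ℕ.≤-trans q≤r (ℕ.m≤m+n _ a) , ℕ.+-monoʳ-≤ (q + a) a≤b , inj₁ (eq q a)
  where
  eq : ∀ q a → q + a + (q + a) ≡ q + (q + a + a)
  eq = ℕ-Ring.solve-∀
... | inj₂ b<a = q + suc (b + b) , ℕ.m≤m+n q _ ,
  subst (q + suc (b + b) ≤_) (sym (ℕ.+-assoc q a b)) (ℕ.+-monoʳ-≤ q (ℕ.+-monoˡ-≤ b b<a)) , inj₂ (eq q a b)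
  where
  eq : ∀ q a b → q + a + (q + a) + (q + suc (b + b)) ≡ suc (q + a + b + (q + a + b)) + q
  eq = ℕ-Ring.solve-∀

halve : ∀ y → ∃ λ a → y ≡ a + a ⊎ y ≡ suc (a + a)
halve zero = 0 , inj₁ refl
halve (suc y) with halve y
... | a , inj₁ refl = a , inj₂ refl
... | a , inj₂ refl = suc a , inj₁ (cong suc (sym (ℕ.+-suc a a)))

unfold : ∀ {q m r′} → q ≤ r′ → r′ ≤ m → ∃ λ r → q ≤ r × r ≤ m × Fold q m r r′
unfold {q} q≤r′ r′≤m with ℕ.m≤n⇒∃[o]m+o≡n q≤r′ | ℕ.m≤n⇒∃[o]m+o≡n r′≤m
... | y , refl | d , refl with halve y
... | a , inj₁ refl = q + a , ℕ.m≤m+n q a ,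
  ℕ.≤-trans (ℕ.+-monoʳ-≤ q (ℕ.m≤m+n a a)) (ℕ.m≤m+n _ d) , inj₁ (eq q a)
  where
  eq : ∀ q a → q + a + (q + a) ≡ q + (q + (a + a))
  eq = ℕ-Ring.solve-∀
-- With `r′ = q + 2b + 1` and `d = m - r′`, this is `m - b`.
... | b , inj₂ refl = q + suc (b + d) , ℕ.m≤m+n q _ ,
  subst (q + suc (b + d) ≤_) (eq′ q b d) (ℕ.m≤m+n _ b) , inj₂ (eq q b d)
  where
  eq : ∀ q b d → q + suc (b + d) + (q + suc (b + d)) + (q + suc (b + b)) ≡
       suc (q + suc (b + b) + d + (q + suc (b + b) + d)) + q
  eq = ℕ-Ring.solve-∀
  eq′ : ∀ q b d → q + suc (b + d) + b ≡ q + suc (b + b) + d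
  eq′ = ℕ-Ring.solve-∀

double-injective : ∀ {a b} → a + a ≡ b + b → a ≡ b
double-injective {zero}  {zero}  e = refl
double-injective {suc a} {suc b} e = cong suc (double-injective (ℕ.suc-injective
  (trans (sym (ℕ.+-suc a a)) (trans (ℕ.suc-injective e) (ℕ.+-suc b b)))))

even≢odd : ∀ a b → ¬ (a + a ≡ suc (b + b))
even≢odd zero          b ()
even≢odd (suc a)       b e = even≢odd b a (sym (trans (sym (ℕ.+-suc a a)) (ℕ.suc-injective e)))

-- The first alternative of `Fold` makes `r′ - q` even, the second makes it odd. Parity thus tells
-- which alternative produced `r′`, and `r` can be recovered.
Fold-even-odd : ∀ {q m r₁ r₂ r′} → r₁ + r₁ ≡ q + r′ → ¬ (r₂ + r₂ + r′ ≡ suc (m + m) + q)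
Fold-even-odd {q} {m} {r₁} {r₂} {r′} e₁ e₂ = even≢odd (r₁ + r₂) (m + q) (begin
  r₁ + r₂ + (r₁ + r₂)  ≡⟨ shuffle r₁ r₂ ⟩
  r₁ + r₁ + (r₂ + r₂)  ≡⟨ cong (_+ (r₂ + r₂)) e₁ ⟩
  q + r′ + (r₂ + r₂)   ≡⟨ shuffle′ q r′ (r₂ + r₂) ⟩
  q + (r₂ + r₂ + r′)   ≡⟨ cong (λ u → q + u) e₂ ⟩
  q + (suc (m + m) + q) ≡⟨ shuffle″ q m ⟩
  suc (m + q + (m + q)) ∎)
  where
  open ≡-Reasoning
  shuffle : ∀ a b → a + b + (a + b) ≡ a + a + (b + b)
  shuffle = ℕ-Ring.solve-∀
  shuffle′ : ∀ a b c → a + b + c ≡ a + (c + b)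
  shuffle′ = ℕ-Ring.solve-∀
  shuffle″ : ∀ q m → q + (suc (m + m) + q) ≡ suc (m + q + (m + q))
  shuffle″ = ℕ-Ring.solve-∀

Fold-injective : ∀ {q m r₁ r₂ r′} → Fold q m r₁ r′ → Fold q m r₂ r′ → r₁ ≡ r₂
Fold-injective          (inj₁ e₁) (inj₁ e₂) = double-injective (trans e₁ (sym e₂))
Fold-injective {r′ = r′} (inj₂ e₁) (inj₂ e₂) =
  double-injective (ℕ.+-cancelʳ-≡ r′ _ _ (trans e₁ (sym e₂)))
Fold-injective {m = m} {r₁} {r₂} (inj₁ e₁) (inj₂ e₂) = ⊥-elim (Fold-even-odd {m = m} {r₁} {r₂} e₁ e₂)
Fold-injective {m = m} {r₁} {r₂} (inj₂ e₁) (inj₁ e₂) = ⊥-elim (Fold-even-odd {m = m} {r₂} {r₁} e₂ e₁)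

-- The vector μ

firstEntry : Bool → Bool → ℕ → ℤ
firstEntry c neg p = if c then l else ℤ.- l
  where l = if neg then ℤ.- (+ p) else + p

lastEntry : Bool → Bool → ℕ → ℕ → ℕ → ℤ
lastEntry c even n q r = if c then l ℤ.- (+ (n ∸ 1)) else (+ n) ℤ.- l
  where l = if even then (+ (2 * r)) ℤ.- (+ q) else ((+ (2 * n ∸ 1)) ℤ.- (+ (2 * r))) ℤ.+ (+ q)

initEven : ℕ → List ℕ → Bool
initEven k ps = isEven (sum (map (λ i → at ps i) (upTo (suc k))))

at-++ : ∀ xs y zs → at (xs ++ y ∷ zs) (length xs) ≡ y
at-++ []       y zs = refl
at-++ (x ∷ xs) y zs = at-++ xs y zs

applyUpTo-shift : ∀ j qs zs f → (∀ i → f i ≡ (+ at (qs ++ zs) i) ℤ.- + (j + i)) →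
                  applyUpTo f (length qs) ≡ shift j qs
applyUpTo-shift j []       zs f h = refl
applyUpTo-shift j (q ∷ qs) zs f h = cong₂ _∷_ (trans (h 0) (cong (λ u → + q ℤ.- + u) (ℕ.+-identityʳ j)))
  (applyUpTo-shift (suc j) qs zs (λ i → f (suc i))
    (λ i → trans (h (suc i)) (cong (λ u → (+ at (qs ++ zs) i) ℤ.- + u) (ℕ.+-suc j i))))

mu-entries : ∀ k π p ms q r → length ms ≡ k → eastsBeforeNorths 0 π ≡ p ∷ ms ++ q ∷ r ∷ [] →
  mu (3 + k) π ≡ firstEntry (case03 (3 + k)) (containsE⁻ π) p ∷
    shift 1 (ms ++ [ q ]) ++ [ lastEntry (case03 (3 + k)) (initEven k (eastsBeforeNorths 0 π)) (3 + k) q r ]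
mu-entries k π p ms q r len e = begin
  mu n π
    ≡⟨ mu-if (case03 n) ⟩
  firstEntry c (containsE⁻ π) (at ps 0) ∷ muMiddle n π ++ [ lastEntry c (initEven k ps) n (at ps (1 + k)) (at ps (2 + k)) ]
    ≡⟨ cong₂ (λ u v → firstEntry c (containsE⁻ π) (at u 0) ∷ v ++ [ lastEntry c (initEven k ps) n (at u (1 + k)) (at u (2 + k)) ]) e middle ⟩
  firstEntry c (containsE⁻ π) p ∷ shift 1 (ms ++ [ q ]) ++
    [ lastEntry c (initEven k ps) n (at (ms ++ q ∷ r ∷ []) k) (at (ms ++ q ∷ r ∷ []) (1 + k)) ]
    ≡⟨ cong₂ (λ u v → firstEntry c (containsE⁻ π) p ∷ shift 1 (ms ++ [ q ]) ++ [ lastEntry c (initEven k ps) n u v ]) at-q at-r ⟩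
  firstEntry c (containsE⁻ π) p ∷ shift 1 (ms ++ [ q ]) ++ [ lastEntry c (initEven k ps) n q r ] ∎
  where
  open ≡-Reasoning
  n  = 3 + k
  c  = case03 n
  ps = eastsBeforeNorths 0 π
  mu-if : ∀ b → (if b then lam1 π ∷ (muMiddle n π ++ [ lamN n π ℤ.- (+ (n ∸ 1)) ])
                 else ℤ.- (lam1 π) ∷ (muMiddle n π ++ [ (+ n) ℤ.- lamN n π ]))
                ≡ firstEntry b (containsE⁻ π) (at ps 0) ∷
                  muMiddle n π ++ [ lastEntry b (initEven k ps) n (at ps (1 + k)) (at ps (2 + k)) ]
  mu-if true  = refl
  mu-if false = refl
  assoc : ms ++ q ∷ r ∷ [] ≡ (ms ++ [ q ]) ++ [ r ]
  assoc = sym (++-assoc ms [ q ] [ r ])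
  len′ : length (ms ++ [ q ]) ≡ suc k
  len′ = trans (length-++ ms) (trans (ℕ.+-comm (length ms) 1) (cong suc len))
  at-q : at (ms ++ q ∷ r ∷ []) k ≡ q
  at-q = subst (λ u → at (ms ++ q ∷ r ∷ []) u ≡ q) len (at-++ ms q [ r ])
  at-r : at (ms ++ q ∷ r ∷ []) (1 + k) ≡ r
  at-r = subst₂ (λ u v → at u v ≡ r) (sym assoc) len′ (at-++ (ms ++ [ q ]) r [])
  entry : ℕ → ℤ
  entry i = (+ piAt π (i + 2)) ℤ.- (+ (i + 1))
  middle : muMiddle n π ≡ shift 1 (ms ++ [ q ])
  middle = trans (map-upTo entry (suc k)) (trans (cong (applyUpTo entry) (sym len′))
    (applyUpTo-shift 1 (ms ++ [ q ]) [ r ] entry λ i →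
      trans (cong₂ (λ u v → (+ at ps (u ∸ 1)) ℤ.- + v) (ℕ.+-comm i 2) (ℕ.+-comm i 1))
            (cong (λ u → (+ at u (suc i)) ℤ.- + (suc i)) (trans e (cong (p ∷_) assoc)))))

-- Both Booleans only choose between `V` and `1 - V`, where `V` is `2r - q - (2 + k)`, and `Fold`
-- says that the folded entry is one of these two. Since `w` to `1 - w` is an involution, the cases
-- combine.
lastEntry-fold : ∀ c even k q r r′ → Fold q (2 + k) r r′ →
  lastEntry c even (3 + k) q r ≡ + r′ ℤ.- + (2 + k)
  ⊎ lastEntry c even (3 + k) q r ≡ 1ℤ ℤ.- (+ r′ ℤ.- + (2 + k))
lastEntry-fold c even k q r r′ h = combine (value h) (reading c even)
  where
  K Q R R′ V : ℤ
  K  = + k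
  Q  = + q
  R  = + r
  R′ = + r′
  V  = R ℤ.+ R ℤ.- Q ℤ.- (+ 2 ℤ.+ K)
  x = lastEntry c even (3 + k) q r
  value : Fold q (2 + k) r r′ → V ≡ R′ ℤ.- (+ 2 ℤ.+ K) ⊎ V ≡ 1ℤ ℤ.- (R′ ℤ.- (+ 2 ℤ.+ K))
  value (inj₁ e) = inj₁ (trans (cong (λ u → + u ℤ.- Q ℤ.- (+ 2 ℤ.+ K)) e) (ring Q R′ K))
    where
    ring : ∀ Q R′ K → Q ℤ.+ R′ ℤ.- Q ℤ.- (+ 2 ℤ.+ K) ≡ R′ ℤ.- (+ 2 ℤ.+ K)
    ring = ℤ-Ring.solve-∀
  value (inj₂ e) = inj₂ (trans (ring₁ (R ℤ.+ R) Q R′ K) (trans (cong (λ u → + u ℤ.- R′ ℤ.- Q ℤ.- (+ 2 ℤ.+ K)) e) (ring₂ Q R′ K)))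
    where
    ring₁ : ∀ D Q R′ K → D ℤ.- Q ℤ.- (+ 2 ℤ.+ K) ≡ D ℤ.+ R′ ℤ.- R′ ℤ.- Q ℤ.- (+ 2 ℤ.+ K)
    ring₁ = ℤ-Ring.solve-∀
    ring₂ : ∀ Q R′ K → 1ℤ ℤ.+ (+ 2 ℤ.+ K ℤ.+ (+ 2 ℤ.+ K)) ℤ.+ Q ℤ.- R′ ℤ.- Q ℤ.- (+ 2 ℤ.+ K) ≡ 1ℤ ℤ.- (R′ ℤ.- (+ 2 ℤ.+ K))
    ring₂ = ℤ-Ring.solve-∀
  reading : ∀ c even → lastEntry c even (3 + k) q r ≡ V ⊎ lastEntry c even (3 + k) q r ≡ 1ℤ ℤ.- V
  reading true  true  = inj₁ (ring K Q R)
    where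
    ring : ∀ K Q R → R ℤ.+ (R ℤ.+ 0ℤ) ℤ.- Q ℤ.- (+ 2 ℤ.+ K) ≡ R ℤ.+ R ℤ.- Q ℤ.- (+ 2 ℤ.+ K)
    ring = ℤ-Ring.solve-∀
  reading true  false = inj₂ (ring K Q R)
    where
    ring : ∀ K Q R → + 2 ℤ.+ K ℤ.+ (+ 3 ℤ.+ K ℤ.+ 0ℤ) ℤ.- (R ℤ.+ (R ℤ.+ 0ℤ)) ℤ.+ Q ℤ.- (+ 2 ℤ.+ K)
           ≡ 1ℤ ℤ.- (R ℤ.+ R ℤ.- Q ℤ.- (+ 2 ℤ.+ K))
    ring = ℤ-Ring.solve-∀
  reading false true  = inj₂ (ring K Q R)
    where
    ring : ∀ K Q R → + 3 ℤ.+ K ℤ.- (R ℤ.+ (R ℤ.+ 0ℤ) ℤ.- Q) ≡ 1ℤ ℤ.- (R ℤ.+ R ℤ.- Q ℤ.- (+ 2 ℤ.+ K))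
    ring = ℤ-Ring.solve-∀
  reading false false = inj₁ (ring K Q R)
    where
    ring : ∀ K Q R → + 3 ℤ.+ K ℤ.- (+ 2 ℤ.+ K ℤ.+ (+ 3 ℤ.+ K ℤ.+ 0ℤ) ℤ.- (R ℤ.+ (R ℤ.+ 0ℤ)) ℤ.+ Q)
           ≡ R ℤ.+ R ℤ.- Q ℤ.- (+ 2 ℤ.+ K)
    ring = ℤ-Ring.solve-∀
  twice : ∀ w → 1ℤ ℤ.- (1ℤ ℤ.- w) ≡ w
  twice = ℤ-Ring.solve-∀
  combine : ∀ {w} → V ≡ w ⊎ V ≡ 1ℤ ℤ.- w → x ≡ V ⊎ x ≡ 1ℤ ℤ.- V → x ≡ w ⊎ x ≡ 1ℤ ℤ.- w
  combine (inj₁ refl) h             = h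
  combine (inj₂ e)    (inj₁ e′)     = inj₂ (trans e′ e)
  combine (inj₂ e)    (inj₂ e′)     = inj₁ (trans e′ (trans (cong (λ u → 1ℤ ℤ.- u) e) (twice _)))

symm-firstEntry : ∀ c neg p a → symm (firstEntry c neg p ∷ a) ≡ symm (+ p ∷ a)
symm-firstEntry true  true  p a = symm-negate-head p a
symm-firstEntry true  false p a = refl
symm-firstEntry false true  p a = cong (λ u → symm (u ∷ a)) (ℤ.neg-involutive (+ p))
symm-firstEntry false false p a = symm-negate-head p a

word-mu : ∀ k π p ms q r r′ → length ms ≡ k → eastsBeforeNorths 0 π ≡ p ∷ ms ++ q ∷ r ∷ [] →
          r′ ≤ 2 + k → Fold q (2 + k) r r′ →
          dropLast (zetaWord (3 + k) (mu (3 + k) π)) ≡ dropLast (word (area p (ms ++ q ∷ r′ ∷ [])))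
word-mu k π p ms q r r′ len e r′≤ h = begin
  dropLast (zetaWord n (mu n π))
    ≡⟨ cong dropLast (zetaWord-levels n (mu n π)) ⟩
  dropLast (levels (2 * n) (symm (mu n π)))
    ≡⟨ cong (λ u → dropLast (levels (2 * n) (symm u))) (mu-entries k π p ms q r len e) ⟩
  dropLast (levels (2 * n) (symm (firstEntry c (containsE⁻ π) p ∷ a ++ [ x ])))
    ≡⟨ cong (λ u → dropLast (levels (2 * n) u)) (symm-firstEntry c (containsE⁻ π) p (a ++ [ x ])) ⟩
  dropLast (levels (2 * n) (symm (+ p ∷ a ++ [ x ])))
    ≡⟨ reflect (lastEntry-fold c (initEven k (eastsBeforeNorths 0 π)) k q r r′ h) ⟩
  dropLast (levels (2 * n) (symm (+ p ∷ a ++ [ + r′ ℤ.- + (2 + k) ])))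
    ≡⟨ cong₂ (λ u v → dropLast (levels (2 * u) (symm v))) (sym len-area) (cong (+ p ∷_) (sym area≡)) ⟩
  dropLast (word (area p (ms ++ q ∷ r′ ∷ []))) ∎
  where
  open ≡-Reasoning
  n = 3 + k
  c = case03 n
  a = shift 1 (ms ++ [ q ])
  x = lastEntry c (initEven k (eastsBeforeNorths 0 π)) n q r
  y = + r′ ℤ.- + (2 + k)
  -- Since `r′` is at most `2 + k`, the folded entry is `ℤ.- + d` and its reflection is `suc d`, the
  -- two forms that `dropLast-reflect` compares.
  d = 2 + k ∸ r′
  y≡ : y ≡ ℤ.- + d
  y≡ = trans (ℤ.[+m]-[+n]≡m⊖n r′ (2 + k)) (ℤ.⊖-≤ r′≤)
  1-y≡ : 1ℤ ℤ.- y ≡ + (suc d)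
  1-y≡ = cong ℤ.suc (trans (cong ℤ.-_ y≡) (ℤ.neg-involutive (+ d)))
  reflect : x ≡ y ⊎ x ≡ 1ℤ ℤ.- y → dropLast (levels (2 * n) (symm (+ p ∷ a ++ [ x ])))
                                  ≡ dropLast (levels (2 * n) (symm (+ p ∷ a ++ [ y ])))
  reflect (inj₁ e) = cong (λ u → dropLast (levels (2 * n) (symm (+ p ∷ a ++ [ u ])))) e
  reflect (inj₂ e) = trans (cong (λ u → dropLast (levels (2 * n) (symm (+ p ∷ a ++ [ u ])))) (trans e 1-y≡))
    (trans (dropLast-reflect (2 * n) (+ p ∷ a) d d<)
           (cong (λ u → dropLast (levels (2 * n) (symm (+ p ∷ a ++ [ u ])))) (sym y≡)))
    where
    d< : suc d < 2 * n
    d< = s≤s (ℕ.≤-trans (s≤s (ℕ.m∸n≤m (2 + k) r′))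
      (ℕ.≤-trans (ℕ.m≤m+n (3 + k) 0) (ℕ.m≤n+m (3 + k + 0) (2 + k))))
  len′ : length (ms ++ [ q ]) ≡ suc k
  len′ = trans (length-++ ms) (trans (ℕ.+-comm (length ms) 1) (cong suc len))
  assoc : ms ++ q ∷ r′ ∷ [] ≡ (ms ++ [ q ]) ++ [ r′ ]
  assoc = sym (++-assoc ms [ q ] [ r′ ])
  area≡ : shift 1 (ms ++ q ∷ r′ ∷ []) ≡ a ++ [ y ]
  area≡ = trans (cong (shift 1) assoc) (trans (shift-∷ʳ 1 (ms ++ [ q ]) r′)
    (cong (λ u → a ++ [ + r′ ℤ.- + (suc u) ]) len′))
  len-area : length (area p (ms ++ q ∷ r′ ∷ [])) ≡ n
  len-area = cong suc (trans (length-shift 1 (ms ++ q ∷ r′ ∷ [])) (trans (cong length assoc)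
    (trans (length-++ (ms ++ [ q ])) (trans (ℕ.+-comm _ 1) (cong suc len′)))))

sgn : Bool → Step
sgn even = if even then E⁺ else E⁻

signOf : List ℤ → Step
signOf a = sgn (isEven (countPos a))

Sign-signOf : ∀ a → Sign (signOf a)
Sign-signOf a with isEven (countPos a)
... | true  = inj₁ refl
... | false = inj₂ refl

isEven-suc : ∀ m → isEven (suc m) ≡ not (isEven m)
isEven-suc zero          = refl
isEven-suc (suc zero)    = refl
isEven-suc (suc (suc m)) = isEven-suc m

-- Negating a nonzero first entry changes the number of positive entries by one. With `a` fixed, the
-- sign of the path and the sign of the word hence determine each other, through the identity or
-- `not`.
signOf-firstEntry : ∀ c x a → Σ (Bool → Bool) λ flip → ∀ neg →
  signOf (firstEntry c neg (suc x) ∷ a) ≡ (if flip neg then E⁻ else E⁺) × flip (flip neg) ≡ neg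
signOf-firstEntry c x a with isEven (countPos a) in ev
signOf-firstEntry true x a | true  = not , λ where
  true  → cong sgn ev , refl
  false → cong sgn (trans (isEven-suc (countPos a)) (cong not ev)) , refl
signOf-firstEntry true x a | false = (λ b → b) , λ where
  true  → cong sgn ev , refl
  false → cong sgn (trans (isEven-suc (countPos a)) (cong not ev)) , refl
signOf-firstEntry false x a | true  = (λ b → b) , λ where
  true  → cong sgn (trans (isEven-suc (countPos a)) (cong not ev)) , refl
  false → cong sgn ev , refl
signOf-firstEntry false x a | false = not , λ where
  true  → cong sgn (trans (isEven-suc (countPos a)) (cong not ev)) , refl
  false → cong sgn ev , refl

-- Paths

Linked-eastsBeforeNorths : ∀ e w → Linked _≤_ (e ∷ eastsBeforeNorths e w ++ [ e + countEast w ])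
Linked-eastsBeforeNorths e w = go e w refl
  where
  weaken : ∀ {i xs} → Linked _≤_ (suc i ∷ xs) → Linked _≤_ (i ∷ xs)
  weaken [-]     = [-]
  weaken (p ∷ l) = ℕ.≤-trans (ℕ.n≤1+n _) p ∷ l
  go : ∀ e w {m} → e + countEast w ≡ m → Linked _≤_ (e ∷ eastsBeforeNorths e w ++ [ m ])
  go e []       refl = ℕ.m≤m+n e 0 ∷ [-]
  go e (N ∷ w)  h    = ℕ.≤-refl ∷ go e w h
  go e (E ∷ w)  h    = weaken (go (suc e) w (trans (sym (ℕ.+-suc e _)) h))
  go e (E⁺ ∷ w) h    = weaken (go (suc e) w (trans (sym (ℕ.+-suc e _)) h))
  go e (E⁻ ∷ w) h    = weaken (go (suc e) w (trans (sym (ℕ.+-suc e _)) h))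

length-eastsBeforeNorths : ∀ e w → length (eastsBeforeNorths e w) ≡ countN w
length-eastsBeforeNorths e []       = refl
length-eastsBeforeNorths e (N ∷ w)  = cong suc (length-eastsBeforeNorths e w)
length-eastsBeforeNorths e (E ∷ w)  = length-eastsBeforeNorths (suc e) w
length-eastsBeforeNorths e (E⁺ ∷ w) = length-eastsBeforeNorths (suc e) w
length-eastsBeforeNorths e (E⁻ ∷ w) = length-eastsBeforeNorths (suc e) w

eastsBeforeNorths-suc≢ : ∀ e w xs → eastsBeforeNorths (suc e) w ≢ e ∷ xs
eastsBeforeNorths-suc≢ e w xs h =
  ℕ.<-irrefl refl (Linked.head (subst (λ u → Linked _≤_ (suc e ∷ u ++ [ suc e + countEast w ])) h
    (Linked-eastsBeforeNorths (suc e) w)))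

plain-injective : ∀ {e w w′} → All Plain w → All Plain w′ →
  eastsBeforeNorths e w ≡ eastsBeforeNorths e w′ → countEast w ≡ countEast w′ → w ≡ w′
plain-injective []               []                h c  = refl
plain-injective []               (inj₁ refl ∷ _)   () c
plain-injective []               (inj₂ refl ∷ _)   h ()
plain-injective (inj₁ refl ∷ _)  []                () c
plain-injective (inj₂ refl ∷ _)  []                h ()
plain-injective (inj₁ refl ∷ pl) (inj₁ refl ∷ pl′) h c =
  cong (N ∷_) (plain-injective pl pl′ (∷-injectiveʳ h) c)
plain-injective {e} {_ ∷ w} {_ ∷ w′} (inj₁ refl ∷ pl) (inj₂ refl ∷ pl′) h c =
  ⊥-elim (eastsBeforeNorths-suc≢ e w′ _ (sym h))
plain-injective {e} {_ ∷ w} {_ ∷ w′} (inj₂ refl ∷ pl) (inj₁ refl ∷ pl′) h c =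
  ⊥-elim (eastsBeforeNorths-suc≢ e w _ h)
plain-injective (inj₂ refl ∷ pl) (inj₂ refl ∷ pl′) h c =
  cong (E ∷_) (plain-injective pl pl′ h (ℕ.suc-injective c))

containsE⁻-plain : ∀ {w} → All Plain w → containsE⁻ w ≡ false
containsE⁻-plain []               = refl
containsE⁻-plain (inj₁ refl ∷ pl) = containsE⁻-plain pl
containsE⁻-plain (inj₂ refl ∷ pl) = containsE⁻-plain pl

-- The counts fix every step up to signs. The first step carries a sign exactly when the first count
-- is positive, which is why the signs are compared only then.
path-injective : ∀ {n p ps π π′} → SignedLatticePath n π → SignedLatticePath n π′ →
  eastsBeforeNorths 0 π ≡ p ∷ ps → eastsBeforeNorths 0 π′ ≡ p ∷ ps →
  (0 < p → containsE⁻ π ≡ containsE⁻ π′) → π ≡ π′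
path-injective {p = p} {ps} {π} {π′} (_ , c , s) (_ , c′ , s′) e e′ = go π π′ s s′ e e′ (trans c (sym c′))
  where
  positive : ∀ w {p ps} → eastsBeforeNorths 1 w ≡ p ∷ ps → 0 < p
  positive w {zero}  h = ⊥-elim (eastsBeforeNorths-suc≢ 0 w _ h)
  positive w {suc p} h = s≤s z≤n
  true≢false : true ≢ false
  true≢false ()
  go : ∀ π π′ → LatticeShape π → LatticeShape π′ → eastsBeforeNorths 0 π ≡ p ∷ ps → eastsBeforeNorths 0 π′ ≡ p ∷ ps →
       countEast π ≡ countEast π′ → (0 < p → containsE⁻ π ≡ containsE⁻ π′) → π ≡ π′
  go (E ∷ w) _ (x≢E , _) _ e e′ c h = ⊥-elim (x≢E refl)
  go (_ ∷ _) (E ∷ w) _ (x≢E , _) e e′ c h = ⊥-elim (x≢E refl)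
  go (N ∷ w) (N ∷ w′) (_ , pl) (_ , pl′) e e′ c h =
    cong (N ∷_) (plain-injective pl pl′ (∷-injectiveʳ (trans e (sym e′))) c)
  go (N ∷ w) (E⁺ ∷ w′) _ _ refl e′ c h = ⊥-elim (eastsBeforeNorths-suc≢ 0 w′ _ e′)
  go (N ∷ w) (E⁻ ∷ w′) _ _ refl e′ c h = ⊥-elim (eastsBeforeNorths-suc≢ 0 w′ _ e′)
  go (E⁺ ∷ w) (N ∷ w′) _ _ e refl c h = ⊥-elim (eastsBeforeNorths-suc≢ 0 w _ e)
  go (E⁻ ∷ w) (N ∷ w′) _ _ e refl c h = ⊥-elim (eastsBeforeNorths-suc≢ 0 w _ e)
  go (E⁺ ∷ w) (E⁺ ∷ w′) (_ , pl) (_ , pl′) e e′ c h =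
    cong (E⁺ ∷_) (plain-injective pl pl′ (trans e (sym e′)) (ℕ.suc-injective c))
  go (E⁻ ∷ w) (E⁻ ∷ w′) (_ , pl) (_ , pl′) e e′ c h =
    cong (E⁻ ∷_) (plain-injective pl pl′ (trans e (sym e′)) (ℕ.suc-injective c))
  go (E⁺ ∷ w) (E⁻ ∷ w′) (_ , pl) _ e e′ c h =
    ⊥-elim (true≢false (trans (sym (h (positive w e))) (containsE⁻-plain pl)))
  go (E⁻ ∷ w) (E⁺ ∷ w′) _ (_ , pl′) e e′ c h =
    ⊥-elim (true≢false (trans (h (positive w e)) (containsE⁻-plain pl′)))

plain-path : ∀ e ps m → Linked _≤_ (e ∷ ps ++ [ m ]) →
  ∃ λ w → All Plain w × eastsBeforeNorths e w ≡ ps × countN w ≡ length ps × e + countEast w ≡ m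
plain-path e [] m (e≤m ∷ _) with ℕ.m≤n⇒∃[o]m+o≡n e≤m
... | d , refl = replicate d E , easts d , none e d , noN d , cong (λ u → e + u) (count d)
  where
  easts : ∀ d → All Plain (replicate d E)
  easts zero    = []
  easts (suc d) = inj₂ refl ∷ easts d
  none : ∀ e d → eastsBeforeNorths e (replicate d E) ≡ []
  none e zero    = refl
  none e (suc d) = none (suc e) d
  noN : ∀ d → countN (replicate d E) ≡ 0
  noN zero    = refl
  noN (suc d) = noN d
  count : ∀ d → countEast (replicate d E) ≡ d
  count zero    = refl
  count (suc d) = cong suc (count d)
plain-path e (p ∷ ps) m (e≤p ∷ l) with ℕ.m≤n⇒∃[o]m+o≡n e≤p | plain-path p ps m l
... | d , refl | w , pl , h , cN , cE = delay e d (N ∷ w) (inj₁ refl ∷ pl) (cong (_ ∷_) h) (cong suc cN) cE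
  where
  delay : ∀ e d w → All Plain w → ∀ {xs n m} → eastsBeforeNorths (e + d) w ≡ xs → countN w ≡ n → (e + d) + countEast w ≡ m →
          ∃ λ w′ → All Plain w′ × eastsBeforeNorths e w′ ≡ xs × countN w′ ≡ n × e + countEast w′ ≡ m
  delay e zero    w pl h c₁ c₂ rewrite ℕ.+-identityʳ e = w , pl , h , c₁ , c₂
  delay e (suc d) w pl h c₁ c₂ rewrite ℕ.+-suc e d with delay (suc e) d w pl h c₁ c₂
  ... | w′ , pl′ , h′ , c₁′ , c₂′ = E ∷ w′ , inj₂ refl ∷ pl′ , h′ , c₁′ , trans (ℕ.+-suc e _) c₂′

path-exists : ∀ n p ps neg → length (p ∷ ps) ≡ suc n → Linked _≤_ (p ∷ ps ++ [ n ]) →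
  ∃ λ π → SignedLatticePath (suc n) π × eastsBeforeNorths 0 π ≡ p ∷ ps × (0 < p → containsE⁻ π ≡ neg)
path-exists n p ps neg len l with plain-path 0 (p ∷ ps) n (z≤n ∷ l)
... | N ∷ w , _ ∷ pl , refl , cN , cE = N ∷ w , (trans cN len , cE , (λ ()) , pl) , refl , λ ()
... | E ∷ w , _ ∷ pl , h , cN , cE with neg
...   | true  = E⁻ ∷ w , (trans cN len , cE , (λ ()) , pl) , h , λ _ → refl
...   | false = E⁺ ∷ w , (trans cN len , cE , (λ ()) , pl) , h , λ _ → containsE⁻-plain pl
path-exists n p ps neg len l | E⁺ ∷ w , inj₁ () ∷ _ , _
path-exists n p ps neg len l | E⁺ ∷ w , inj₂ () ∷ _ , _
path-exists n p ps neg len l | E⁻ ∷ w , inj₁ () ∷ _ , _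
path-exists n p ps neg len l | E⁻ ∷ w , inj₂ () ∷ _ , _

-- Assembling the bijection

lastTwo : ∀ {A : Set} (x y : A) xs → ∃₂ λ ms q → ∃ λ r → x ∷ y ∷ xs ≡ ms ++ q ∷ r ∷ [] × length ms ≡ length xs
lastTwo x y []       = [] , x , y , refl , refl
lastTwo x y (z ∷ xs) with lastTwo y z xs
... | ms , q , r , e , l = x ∷ ms , q , r , cong (x ∷_) e , cong suc l

lastThree : ∀ {A : Set} k (ps : List A) → length ps ≡ 2 + k →
            ∃₂ λ ms q → ∃ λ r → ps ≡ ms ++ q ∷ r ∷ [] × length ms ≡ k
lastThree k (x ∷ y ∷ xs) e with lastTwo x y xs
... | ms , q , r , e′ , l = ms , q , r , e′ , trans l (ℕ.suc-injective (ℕ.suc-injective e))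

Linked-last⁻ : ∀ xs {q r m} → Linked _≤_ (xs ++ q ∷ r ∷ m ∷ []) → q ≤ r × r ≤ m
Linked-last⁻ []           (a ∷ b ∷ _) = a , b
Linked-last⁻ (x ∷ [])     (_ ∷ l)     = Linked-last⁻ [] l
Linked-last⁻ (x ∷ y ∷ xs) (_ ∷ l)     = Linked-last⁻ (y ∷ xs) l

Linked-last⁺ : ∀ xs {q r m r′} → Linked _≤_ (xs ++ q ∷ r ∷ m ∷ []) → q ≤ r′ → r′ ≤ m →
               Linked _≤_ (xs ++ q ∷ r′ ∷ m ∷ [])
Linked-last⁺ []           _       a b = a ∷ b ∷ [-]
Linked-last⁺ (x ∷ [])     (h ∷ l) a b = h ∷ Linked-last⁺ [] l a b
Linked-last⁺ (x ∷ y ∷ xs) (h ∷ l) a b = h ∷ Linked-last⁺ (y ∷ xs) l a b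

-- A path together with its folded last count `r′`. For `3 + k` North steps the first count `p`, the
-- last but one `q` and the last `r` are three separate entries. Replacing `r` by `r′` gives the
-- core vector that has the unsigned word of the path.
record Unfolded (k : ℕ) (π : List Step) : Set where
  field
    p q r r′ : ℕ
    ms       : List ℕ
    counts   : eastsBeforeNorths 0 π ≡ p ∷ ms ++ q ∷ r ∷ []
    len      : length ms ≡ k
    r′≤      : r′ ≤ 2 + k
    folded   : Fold q (2 + k) r r′
    linked   : Linked _≤_ (p ∷ (ms ++ q ∷ r′ ∷ []) ++ [ 2 + k ])

  core : List ℤ
  core = area p (ms ++ q ∷ r′ ∷ [])

  length-counts : length (ms ++ q ∷ r′ ∷ []) ≡ 2 + k
  length-counts = trans (length-++ ms) (trans (ℕ.+-comm (length ms) 2) (cong (λ u → 2 + u) len))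

  length-core : length core ≡ 3 + k
  length-core = cong suc (trans (length-shift 1 (ms ++ q ∷ r′ ∷ [])) length-counts)

  Core-core : Core core
  Core-core = Core-area p _ (subst (λ u → Linked _≤_ (p ∷ (ms ++ q ∷ r′ ∷ []) ++ [ u ])) (sym length-counts) linked)

  core-word : dropLast (zetaWord (3 + k) (mu (3 + k) π)) ≡ dropLast (word core)
  core-word = word-mu k π p ms q r r′ len counts r′≤ folded

  plain : All Plain (dropLast (word core))
  plain = All.++⁻ˡ _ (subst (All Plain) (word-∷ʳ {core} Core-core) (WordCounts.plain (wordCounts {core} Core-core)))

unfolded : ∀ {k π} → SignedLatticePath (3 + k) π → Unfolded k π
unfolded {k} {π} (cN , cE , _) = go (eastsBeforeNorths 0 π) refl
  (trans (length-eastsBeforeNorths 0 π) cN)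
  (subst (λ u → Linked _≤_ (0 ∷ eastsBeforeNorths 0 π ++ [ u ])) cE (Linked-eastsBeforeNorths 0 π))
  where
  go : ∀ ps → eastsBeforeNorths 0 π ≡ ps → length ps ≡ 3 + k → Linked _≤_ (0 ∷ ps ++ [ 2 + k ]) → Unfolded k π
  go (p ∷ ps) e l (_ ∷ lk) with lastThree k ps (ℕ.suc-injective l)
  ... | ms , q , r , refl , len with subst (λ u → Linked _≤_ (p ∷ u)) (++-assoc ms (q ∷ r ∷ []) [ 2 + k ]) lk
  ...   | lk′ with Linked-last⁻ (p ∷ ms) lk′
  ...     | q≤r , r≤m with fold q≤r r≤m
  ...       | r′ , q≤r′ , r′≤m , f = record
    { counts = e ; len = len ; r′≤ = r′≤m ; folded = f
    ; linked = subst (λ u → Linked _≤_ (p ∷ u)) (sym (++-assoc ms (q ∷ r′ ∷ []) [ 2 + k ])) (Linked-last⁺ (p ∷ ms) lk′ q≤r′ r′≤m) }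

zeta-signed : ∀ {k π} → Unfolded k π → SignedBallotPath (3 + k) (zetaD (3 + k) π)
zeta-signed {k} {π} u = len-zeta , Ballot-unsign⁻ (subst Ballot (sym unsigned) ballot) , shape
  where
  open Unfolded u
  s = signOf (mu (3 + k) π)
  w = dropLast (word core)
  open WordCounts (wordCounts {core} Core-core) using () renaming (ballot to ballot-word; len to len-word)
  zeta≡ : zetaD (3 + k) π ≡ signAfter (3 + k) s w
  zeta≡ = cong (signAfter (3 + k) s) core-word
  unsigned : map unsign (zetaD (3 + k) π) ≡ w
  unsigned = trans (cong (map unsign) zeta≡) (unsign-signAfter (3 + k) (Sign-signOf (mu (3 + k) π)) plain)
  ballot : Ballot w
  ballot p q e = ballot-word p (q ++ [ N ]) (trans (sym (++-assoc p q [ N ]))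
    (trans (cong (_++ [ N ]) e) (sym (word-∷ʳ {core} Core-core))))
  shape : BallotShape (3 + k) (zetaD (3 + k) π)
  shape = subst (BallotShape (3 + k)) (sym zeta≡) (BallotShape-signAfter (2 + k) (Sign-signOf (mu (3 + k) π)) plain)
  len-zeta : length (zetaD (3 + k) π) ≡ 2 * (3 + k) ∸ 1
  len-zeta = begin
    length (zetaD (3 + k) π)              ≡⟨ length-map unsign (zetaD (3 + k) π) ⟨
    length (map unsign (zetaD (3 + k) π)) ≡⟨ cong length unsigned ⟩
    length w                              ≡⟨ ℕ.m+n∸n≡m (length w) 1 ⟨
    length w + 1 ∸ 1                      ≡⟨ cong (_∸ 1) (length-++ w) ⟨
    length (w ++ [ N ]) ∸ 1               ≡⟨ cong (λ u → length u ∸ 1) (word-∷ʳ {core} Core-core) ⟨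
    length (word core) ∸ 1                ≡⟨ cong (_∸ 1) (trans len-word (cong (2 *_) length-core)) ⟩
    2 * (3 + k) ∸ 1 ∎
    where open ≡-Reasoning

lastTwo-injective : ∀ {A : Set} (ms ms′ : List A) {q q′ r r′} →
  ms ++ q ∷ r ∷ [] ≡ ms′ ++ q′ ∷ r′ ∷ [] → ms ≡ ms′ × q ≡ q′ × r ≡ r′
lastTwo-injective ms ms′ {q} {q′} {r} {r′} e
  with ∷ʳ-injective (ms ++ [ q ]) (ms′ ++ [ q′ ]) (trans (++-assoc ms _ _) (trans e (sym (++-assoc ms′ _ _))))
... | e′ , er with ∷ʳ-injective ms ms′ e′
... | em , eq = em , eq , er

zeta-core : ∀ {k π} (u : Unfolded k π) →
            zetaD (3 + k) π ≡ signAfter (3 + k) (signOf (mu (3 + k) π)) (dropLast (word (Unfolded.core u)))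
zeta-core {k} {π} u = cong (signAfter (3 + k) (signOf (mu (3 + k) π))) (Unfolded.core-word u)

sgn-injective : ∀ {a b} → (if a then E⁻ else E⁺) ≡ (if b then E⁻ else E⁺) → a ≡ b
sgn-injective {true}  {true}  e = refl
sgn-injective {false} {false} e = refl

mu-counts : ∀ {k π} (u : Unfolded k π) → let open Unfolded u in
  mu (3 + k) π ≡ firstEntry (case03 (3 + k)) (containsE⁻ π) p ∷ shift 1 (ms ++ [ q ]) ++
    [ lastEntry (case03 (3 + k)) (initEven k (p ∷ ms ++ q ∷ r ∷ [])) (3 + k) q r ]
mu-counts {k} {π} u = trans (mu-entries k π p ms q r len counts)
  (cong (λ v → firstEntry (case03 (3 + k)) (containsE⁻ π) p ∷ shift 1 (ms ++ [ q ]) ++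
    [ lastEntry (case03 (3 + k)) (initEven k v) (3 + k) q r ]) counts)
  where open Unfolded u

signAfter-unsigned : ∀ k {s s′ w w′} → Sign s → Sign s′ → All Plain w → All Plain w′ →
                     signAfter k s w ≡ signAfter k s′ w′ → w ≡ w′
signAfter-unsigned k sg sg′ pl pl′ e =
  trans (sym (unsign-signAfter k sg pl)) (trans (cong (map unsign) e) (unsign-signAfter k sg′ pl′))

signAfter-firstEntry : ∀ {n} c a p ps neg neg′ → Core (area p ps) → length (area p ps) ≡ suc n →
  signAfter (suc n) (signOf (firstEntry c neg p ∷ a)) (dropLast (word (area p ps))) ≡
  signAfter (suc n) (signOf (firstEntry c neg′ p ∷ a)) (dropLast (word (area p ps))) →
  0 < p → neg ≡ neg′
signAfter-firstEntry {n} c a (suc x) ps neg neg′ co len h _ =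
  trans (sym (proj₂ (f neg))) (trans (cong flip (sgn-injective
    (trans (sym (proj₁ (f neg))) (trans s≡ (proj₁ (f neg′)))))) (proj₂ (f neg′)))
  where
  flip = proj₁ (signOf-firstEntry c x a)
  f    = proj₂ (signOf-firstEntry c x a)
  s≡ : signOf (firstEntry c neg (suc x) ∷ a) ≡ signOf (firstEntry c neg′ (suc x) ∷ a)
  s≡ = signAfter-core-suc {n} {x} {shift 1 ps} co (ℕ.suc-injective len) h

zeta-injective : ∀ {k π π′} → Unfolded k π → Unfolded k π′ → SignedLatticePath (3 + k) π → SignedLatticePath (3 + k) π′ →
                 zetaD (3 + k) π ≡ zetaD (3 + k) π′ → π ≡ π′
zeta-injective {k} {π} {π′} u u′ slp slp′ e = conclude counts≡
  where
  module U  = Unfolded u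
  module U′ = Unfolded u′
  n  = 3 + k
  words≡ : dropLast (word U.core) ≡ dropLast (word U′.core)
  words≡ = signAfter-unsigned n {w = dropLast (word U.core)} {dropLast (word U′.core)}
    (Sign-signOf (mu n π)) (Sign-signOf (mu n π′)) U.plain U′.plain
    (trans (sym (zeta-core u)) (trans e (zeta-core u′)))
  core≡ : U.core ≡ U′.core
  core≡ = word-injective {U.core} {U′.core} U.Core-core U′.Core-core words≡
  counts≡ : U.p ≡ U′.p × U.ms ≡ U′.ms × U.q ≡ U′.q × U.r′ ≡ U′.r′
  counts≡ = ℤ.+-injective (∷-injectiveˡ core≡) ,
    lastTwo-injective U.ms U′.ms (shift-injective 1 (U.ms ++ U.q ∷ U.r′ ∷ []) (U′.ms ++ U′.q ∷ U′.r′ ∷ []) (∷-injectiveʳ core≡))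
  conclude : U.p ≡ U′.p × U.ms ≡ U′.ms × U.q ≡ U′.q × U.r′ ≡ U′.r′ → π ≡ π′
  conclude (p≡ , ms≡ , q≡ , r′≡) = path-injective slp slp′ U.counts (trans U′.counts (sym list≡)) signs
    where
    r≡ : U.r ≡ U′.r
    r≡ = Fold-injective {m = 2 + k} {r′ = U.r′} U.folded
      (subst₂ (λ a b → Fold a (2 + k) U′.r b) (sym q≡) (sym r′≡) U′.folded)
    list≡ : U.p ∷ U.ms ++ U.q ∷ U.r ∷ [] ≡ U′.p ∷ U′.ms ++ U′.q ∷ U′.r ∷ []
    list≡ = cong₂ _∷_ p≡ (cong₂ _++_ ms≡ (cong₂ (λ a b → a ∷ b ∷ []) q≡ r≡))
    c = case03 n
    -- Apart from its first entry, `mu` depends on the counts alone, the parity in its last entry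
    -- included. These agree by now, so both paths share the tail `a`.
    a = shift 1 (U.ms ++ [ U.q ]) ++ [ lastEntry c (initEven k (U.p ∷ U.ms ++ U.q ∷ U.r ∷ [])) n U.q U.r ]
    mu′≡ : mu n π′ ≡ firstEntry c (containsE⁻ π′) U.p ∷ a
    mu′≡ = trans (mu-entries k π′ U.p U.ms U.q U.r U.len (trans U′.counts (sym list≡)))
      (cong (λ v → firstEntry c (containsE⁻ π′) U.p ∷ shift 1 (U.ms ++ [ U.q ]) ++
        [ lastEntry c (initEven k v) n U.q U.r ]) (trans U′.counts (sym list≡)))
    same : signAfter n (signOf (firstEntry c (containsE⁻ π) U.p ∷ a)) (dropLast (word U.core)) ≡
           signAfter n (signOf (firstEntry c (containsE⁻ π′) U.p ∷ a)) (dropLast (word U.core))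
    same = begin
      signAfter n (signOf (firstEntry c (containsE⁻ π) U.p ∷ a)) (dropLast (word U.core))
        ≡⟨ cong (λ v → signAfter n (signOf v) (dropLast (word U.core))) (mu-counts u) ⟨
      signAfter n (signOf (mu n π)) (dropLast (word U.core))
        ≡⟨ trans (sym (zeta-core u)) (trans e (zeta-core u′)) ⟩
      signAfter n (signOf (mu n π′)) (dropLast (word U′.core))
        ≡⟨ cong₂ (λ v v′ → signAfter n (signOf v) (dropLast (word v′))) mu′≡ (sym core≡) ⟩
      signAfter n (signOf (firstEntry c (containsE⁻ π′) U.p ∷ a)) (dropLast (word U.core)) ∎
      where open ≡-Reasoning
    signs : 0 < U.p → containsE⁻ π ≡ containsE⁻ π′
    signs = signAfter-firstEntry c a U.p (U.ms ++ U.q ∷ U.r′ ∷ []) (containsE⁻ π) (containsE⁻ π′)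
      U.Core-core U.length-core same

-- For a first count 0 neither side receives a sign, and `false` is an arbitrary value. Otherwise
-- the wanted sign is pulled back through `flip`, its own inverse.
choose-sign : ∀ {n s} c a p ps → Core (area p ps) → length (area p ps) ≡ suc n → Sign s →
  ∃ λ neg → ∀ neg′ → (0 < p → neg′ ≡ neg) →
    signAfter (suc n) (signOf (firstEntry c neg′ p ∷ a)) (dropLast (word (area p ps))) ≡
    signAfter (suc n) s (dropLast (word (area p ps)))
choose-sign c a zero ps co len sg = false , λ neg′ _ →
  trans (signAfter-core-zero _ co (ℕ.suc-injective len)) (sym (signAfter-core-zero _ co (ℕ.suc-injective len)))
choose-sign {n} {s} c a (suc x) ps co len sg = flip (minus sg) , λ neg′ h →
  cong (λ u → signAfter (suc n) u (dropLast (word (area (suc x) ps))))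
    (trans (proj₁ (f neg′)) (trans (cong (λ b → if b then E⁻ else E⁺)
      (trans (cong flip (h (s≤s z≤n))) (proj₂ (f (minus sg))))) (minus-sign sg)))
  where
  flip = proj₁ (signOf-firstEntry c x a)
  f    = proj₂ (signOf-firstEntry c x a)
  minus : Sign s → Bool
  minus (inj₁ _) = false
  minus (inj₂ _) = true
  minus-sign : ∀ sg → (if minus sg then E⁻ else E⁺) ≡ s
  minus-sign (inj₁ refl) = refl
  minus-sign (inj₂ refl) = refl

word-preimage : ∀ k {s} p ps → Core (area p ps) → length (area p ps) ≡ 3 + k →
  Linked _≤_ (p ∷ ps ++ [ length ps ]) → Sign s →
  ∃ λ π → SignedLatticePath (3 + k) π × zetaD (3 + k) π ≡ signAfter (3 + k) s (dropLast (word (area p ps)))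
word-preimage k {s} p ps co len lk sg = split (lastThree k ps len-ps)
  where
  n = 3 + k
  c = case03 n
  len-ps : length ps ≡ 2 + k
  len-ps = trans (sym (length-shift 1 ps)) (ℕ.suc-injective len)
  split : (∃₂ λ ms q → ∃ λ r′ → ps ≡ ms ++ q ∷ r′ ∷ [] × length ms ≡ k) →
          ∃ λ π → SignedLatticePath n π × zetaD n π ≡ signAfter n s (dropLast (word (area p ps)))
  split (ms , q , r′ , refl , len-ms) = extend (unfold (proj₁ bounds) (proj₂ bounds))
    where
    lk′ : Linked _≤_ (p ∷ ms ++ q ∷ r′ ∷ 2 + k ∷ [])
    lk′ = subst (λ u → Linked _≤_ (p ∷ u)) (++-assoc ms (q ∷ r′ ∷ []) [ 2 + k ])
      (subst (λ u → Linked _≤_ (p ∷ (ms ++ q ∷ r′ ∷ []) ++ [ u ])) len-ps lk)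
    bounds : q ≤ r′ × r′ ≤ 2 + k
    bounds = Linked-last⁻ (p ∷ ms) lk′
    extend : (∃ λ r → q ≤ r × r ≤ 2 + k × Fold q (2 + k) r r′) →
             ∃ λ π → SignedLatticePath n π × zetaD n π ≡ signAfter n s (dropLast (word (area p ps)))
    extend (r , q≤r , r≤ , f) = finish (path-exists (2 + k) p (ms ++ q ∷ r ∷ []) (proj₁ choice) len-r
        (subst (λ u → Linked _≤_ (p ∷ u)) (sym (++-assoc ms (q ∷ r ∷ []) [ 2 + k ])) (Linked-last⁺ (p ∷ ms) lk′ q≤r r≤)))
      where
      len-r : length (p ∷ ms ++ q ∷ r ∷ []) ≡ n
      len-r = cong suc (trans (length-++ ms) (trans (sym (length-++ ms {q ∷ r′ ∷ []})) len-ps))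
      -- The sign depends on the number of positive entries of the actual `mu`, with its last entry
      -- not folded. Hence `r` is recovered before the sign of the path is chosen.
      a = shift 1 (ms ++ [ q ]) ++ [ lastEntry c (initEven k (p ∷ ms ++ q ∷ r ∷ [])) n q r ]
      choice = choose-sign {2 + k} {s} c a p ps co len sg
      finish : (∃ λ π → SignedLatticePath n π × eastsBeforeNorths 0 π ≡ p ∷ ms ++ q ∷ r ∷ [] ×
                  (0 < p → containsE⁻ π ≡ proj₁ choice)) →
               ∃ λ π → SignedLatticePath n π × zetaD n π ≡ signAfter n s (dropLast (word (area p ps)))
      finish (π , slp , e , neg) = π , slp , trans (zeta-core u)
        (trans (cong (λ v → signAfter n (signOf v) (dropLast (word (area p ps)))) (mu-counts u))
               (proj₂ choice (containsE⁻ π) neg))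
        where
        u : Unfolded k π
        u = record { p = p ; q = q ; r = r ; r′ = r′ ; ms = ms ; counts = e ; len = len-ms
                   ; r′≤ = proj₂ bounds ; folded = f
                   ; linked = subst (λ v → Linked _≤_ (p ∷ (ms ++ q ∷ r′ ∷ []) ++ [ v ])) len-ps lk }

zeta-surjective : ∀ {k β} → SignedBallotPath (3 + k) β →
                  ∃ λ π → SignedLatticePath (3 + k) π × zetaD (3 + k) π ≡ β
zeta-surjective {k} {β} (len , ballot , shape) = go (signAfter-unsign (2 + k) β shape)
  (word-surjective (2 + k) w (trans (length-map unsign β) len) (plain-unsign β) (Ballot-unsign⁺ ballot))
  where
  n = 3 + k
  w = map unsign β
  go : (∃ λ s → Sign s × β ≡ signAfter n s w) →
       (∃ λ d → Core d × length d ≡ n × dropLast (word d) ≡ w) →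
       ∃ λ π → SignedLatticePath n π × zetaD n π ≡ β
  go (s , sg , β≡) (d , co , len-d , w≡) = by-area (Core-area⁻ co)
    where
    by-area : (∃₂ λ p ps → d ≡ area p ps × Linked _≤_ (p ∷ ps ++ [ length ps ])) →
              ∃ λ π → SignedLatticePath n π × zetaD n π ≡ β
    by-area (p , ps , d≡ , lk) = finish (word-preimage k p ps (subst Core d≡ co)
        (trans (cong length (sym d≡)) len-d) lk sg)
      where
      finish : (∃ λ π → SignedLatticePath n π × zetaD n π ≡ signAfter n s (dropLast (word (area p ps)))) →
               ∃ λ π → SignedLatticePath n π × zetaD n π ≡ β
      finish (π , slp , e) = π , slp , trans e
        (trans (cong (λ u → signAfter n s (dropLast (word u))) (sym d≡))
               (trans (cong (signAfter n s) w≡) (sym β≡)))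

theorem5p23 : (n : ℕ) → 3 ≤ n →
    ((π : List Step) → SignedLatticePath n π → SignedBallotPath n (zetaD n π))
    × ((π π′ : List Step) → SignedLatticePath n π → SignedLatticePath n π′ →
    zetaD n π ≡ zetaD n π′ → π ≡ π′)
    × ((β : List Step) → SignedBallotPath n β →
    ∃ λ π → SignedLatticePath n π × zetaD n π ≡ β)
theorem5p23 (suc (suc (suc k))) (s≤s (s≤s (s≤s z≤n))) =
  (λ π slp → zeta-signed (unfolded slp)) ,
  (λ π π′ slp slp′ → zeta-injective (unfolded slp) (unfolded slp′) slp slp′) , (λ β → zeta-surjective)
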